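{- For every integer $n \ge 3$ there exists a smooth lattice polytope $P \subset \mathbb{R}^n$ of dimension $n$ such that, writing its Ehrhart polynomial as $i(P,t)=\sum_{j=0}^n c_j t^j$, the coefficient $c_j$ is negative for every $j = 1, \ldots, n-2$.
   Context: A lattice polytope is the convex hull of finitely many points of $\mathbb{Z}^n$. An $n$-dimensional lattice polytope $P\subset\mathbb{R}^n$ is smooth if each vertex lies in exactly $n$ edges and the primitive edge directions at each vertex form a basis of the lattice $\mathbb{Z}^n$. The Ehrhart polynomial $i(P,t)$ is the unique polynomial with $i(P,t)=|tP\cap\mathbb{Z}^n|$ for all integers $t>0$; it has degree $\dim P$. -}

module Defs where

open import Data.Nat as ℕ using (ℕ; zero; suc)
open import Data.Nat.Divisibility as ℕD using ()
open import Data.Integer as ℤ using (ℤ; +_; ∣_∣)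
open import Data.Rational as ℚ using (ℚ; 0ℚ; 1ℚ)
open import Data.Fin using (Fin; zero; suc)
open import Data.Vec using (Vec; []; _∷_; zipWith; map; replicate; lookup)
open import Data.List using (List; length)
open import Data.List.Membership.Propositional using (_∈_)
open import Data.List.Relation.Unary.Unique.Propositional using (Unique)
open import Data.Product using (Σ; ∃; _×_)
open import Function.Bundles using (_⇔_)
open import Function.Definitions using (Injective)
open import Relation.Binary.PropositionalEquality using (_≡_; _≢_)

Pt : ℕ → Set
Pt n = Vec ℤ n

Σℤ : ∀ {m} → (Fin m → ℤ) → ℤ
Σℤ {zero}  f = + 0
Σℤ {suc m} f = f zero ℤ.+ Σℤ (λ i → f (suc i))

Σℚ : ∀ {m} → (Fin m → ℚ) → ℚ
Σℚ {zero}  f = 0ℚ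
Σℚ {suc m} f = f zero ℚ.+ Σℚ (λ i → f (suc i))

Σv : ∀ {m n} → (Fin m → Pt n) → Pt n
Σv {zero}  f = replicate _ (+ 0)
Σv {suc m} f = zipWith ℤ._+_ (f zero) (Σv (λ i → f (suc i)))

dot : ∀ {n} → Pt n → Pt n → ℤ
dot []       []       = + 0
dot (x ∷ xs) (y ∷ ys) = x ℤ.* y ℤ.+ dot xs ys

_-ᵥ_ : ∀ {n} → Pt n → Pt n → Pt n
u -ᵥ v = zipWith ℤ._-_ u v

scale : ∀ {n} → ℤ → Pt n → Pt n
scale k v = map (k ℤ.*_) v

powℚ : ℚ → ℕ → ℚ
powℚ q zero    = 1ℚ
powℚ q (suc k) = q ℚ.* powℚ q k

ι : ℤ → ℚ
ι z = z ℚ./ 1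

-- A lattice polytope P = conv{V 0, …, V (m-1)} ⊂ ℝ^n is given by a list of
-- lattice points V : Fin m → ℤ^n; we require that these are exactly the
-- vertices of P, i.e. each V i is exposed: some linear functional a
-- attains its maximum over P uniquely at V i.
IsVertex : ∀ {m n} → (Fin m → Pt n) → Fin m → Set
IsVertex V i = ∃ λ a → ∀ j → j ≢ i → dot a (V j) ℤ.< dot a (V i)

FullDim : ∀ {m n} → (Fin m → Pt n) → Set
FullDim {n = n} V = ∀ a → (∀ i j → dot a (V i) ≡ dot a (V j)) → a ≡ replicate n (+ 0)

Edge : ∀ {m n} → (Fin m → Pt n) → Fin m → Fin m → Set
Edge V i j = i ≢ j × (∃ λ a → dot a (V i) ≡ dot a (V j)
                        × (∀ k → k ≢ i → k ≢ j → dot a (V k) ℤ.< dot a (V i)))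

Primitive : ∀ {n} → Pt n → Set
Primitive d = ∀ (g : ℕ) → (∀ k → g ℕD.∣ ∣ lookup d k ∣) → g ≡ 1

PrimEdgeDir : ∀ {n} → Pt n → Pt n → Pt n → Set
PrimEdgeDir v w d = Primitive d × (∃ λ (k : ℕ) → w -ᵥ v ≡ scale (+ k) d)

lincomb : ∀ {n} → (Fin n → ℤ) → (Fin n → Pt n) → Pt n
lincomb c d = Σv (λ i → scale (c i) (d i))

IsLatticeBasis : ∀ {n} → (Fin n → Pt n) → Set
IsLatticeBasis {n} d =
  (∀ (z : Pt n) → ∃ λ c → z ≡ lincomb c d)
  × (∀ c → lincomb c d ≡ replicate n (+ 0) → ∀ i → c i ≡ + 0)

Smooth : ∀ {m n} → (Fin m → Pt n) → Set
Smooth {m} {n} V = ∀ (i : Fin m) → Σ (Fin n → Fin m) λ nb →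
  Injective _≡_ _≡_ nb
  × (∀ k → Edge V i (nb k))
  × (∀ j → Edge V i j → ∃ λ k → nb k ≡ j)
  × (∃ λ (d : Fin n → Pt n) → (∀ k → PrimEdgeDir (V i) (V (nb k)) (d k)) × IsLatticeBasis d)

InDilate : ∀ {m n} → (Fin m → Pt n) → ℕ → Pt n → Set
InDilate {m} {n} V t x = ∃ λ (w : Fin m → ℚ) →
  (∀ i → 0ℚ ℚ.≤ w i) × Σℚ w ≡ 1ℚ
  × (∀ (k : Fin n) → Σℚ (λ i → w i ℚ.* ι (+ t ℤ.* lookup (V i) k)) ≡ ι (lookup x k))

IsEhrhartPoly : ∀ {m n} → (Fin m → Pt n) → (Fin (suc n) → ℚ) → Set
IsEhrhartPoly {m} {n} V c = ∀ (t : ℕ) → 1 ℕ.≤ t →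
  ∃ λ (L : List (Pt n)) → Unique L × (∀ x → (x ∈ L) ⇔ InDilate V t x)
    × ι (+ length L) ≡ Σℚ (λ j → c j ℚ.* powℚ (ι (+ t)) (Data.Fin.toℕ j))

{-# OPTIONS --safe #-}
module Submission where

-- For a smooth polytope P and an affine function h that is positive on P, the prism
-- {(y , x) : x ∈ P, 0 ≤ y ≤ h x} is again smooth, with the lattice points of its dilates
-- fibred over those of P. Three such steps from a point give a combinatorial cube Q ⊂ ℝ³
-- whose bottom and top are rectangles of sizes (1+r) × 1 and 1 × (1+r). Its linear Ehrhart
-- coefficient is of order -r²/6 (the Hodge index theorem makes the self-intersection of the
-- difference of the two rectangles negative), whereas the quadratic one is of order r and
-- the cubic one of order r²/6. Multiplying by segments [0 , m] multiplies the Ehrhart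
-- polynomial by 1 + m t. If the m are chosen from the last one to the first, with r after
-- all of them, then the linear term stays negative and each product makes one more
-- coefficient negative.

open import Defs
open import Data.Bool using (Bool; true; false; not; if_then_else_)
import Data.Bool.Properties as 𝔹
open import Data.Fin as F using (Fin; zero; suc; toℕ; splitAt; join)
import Data.Fin.Properties as FP
open import Data.Integer as ℤ using (ℤ; +_; -[1+_]; -_; _+_; _*_; _-_; _^_; ∣_∣)
import Data.Integer.Properties as ℤP
open import Data.Integer.Tactic.RingSolver using (solve-∀)
open import Data.List as L using (List; []; _∷_; length; concatMap; downFrom; _++_)
open import Data.List.Membership.Propositional using (_∈_; find; lose)
open import Data.List.Membership.Propositional.Properties
  using (∈-map⁺; ∈-map⁻; ∈-concatMap⁺; ∈-concatMap⁻; ∈-downFrom⁺; ∈-downFrom⁻)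
import Data.List.Properties as L
open import Data.List.Relation.Unary.All as All using ([]; _∷_)
import Data.List.Relation.Unary.All.Properties as All
open import Data.List.Relation.Unary.AllPairs as AllPairs using ([]; _∷_)
import Data.List.Relation.Unary.AllPairs.Properties as AllPairs
open import Data.List.Relation.Unary.Any using (here; there)
open import Data.List.Relation.Unary.Unique.Propositional using (Unique)
import Data.List.Relation.Unary.Unique.Propositional.Properties as Unique
open import Data.Nat as ℕ using (ℕ; zero; suc; _≤_; _∸_)
import Data.Nat.Divisibility as ℕD
import Data.Nat.Properties as ℕP
open import Data.Product using (Σ; ∃; _×_; _,_; proj₁; proj₂)
open import Data.Rational as ℚ using (ℚ; 0ℚ; 1ℚ; _<_)
import Data.Rational.Properties as ℚP
import Data.Rational.Unnormalised as ℚᵘ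
import Data.Rational.Unnormalised.Properties as ℚᵘP
open import Data.Sum using (_⊎_; inj₁; inj₂; [_,_]′)
open import Data.Vec using ([]; _∷_; zipWith; replicate; lookup; head; tail)
import Data.Vec.Properties as VP
open import Function using (_∘_)
open import Function.Bundles using (_⇔_; mk⇔; Equivalence)
open import Function.Definitions using (Injective)
open import Relation.Binary.PropositionalEquality
open import Relation.Nullary using (¬_; yes; no; contradiction)

-- Integer vectors and sums

_+ᵥ_ : ∀ {n} → Pt n → Pt n → Pt n
u +ᵥ v = zipWith _+_ u v

0ᵥ : ∀ {n} → Pt n
0ᵥ = replicate _ (+ 0)

private
  dot-comm-step : ∀ x y d → x * y + d ≡ y * x + d
  dot-comm-step = solve-∀
  dot-+-step : ∀ a b x d e → (a + b) * x + (d + e) ≡ (a * x + d) + (b * x + e)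
  dot-+-step = solve-∀
  dot---step : ∀ a b x d e → (a - b) * x + (d - e) ≡ (a * x + d) - (b * x + e)
  dot---step = solve-∀
  dot-scale-step : ∀ k a x d → (k * a) * x + k * d ≡ k * (a * x + d)
  dot-scale-step = solve-∀

dot-comm : ∀ {n} (u v : Pt n) → dot u v ≡ dot v u
dot-comm []       []       = refl
dot-comm (x ∷ xs) (y ∷ ys) rewrite dot-comm xs ys = dot-comm-step x y _

dot-+ˡ : ∀ {n} (a b v : Pt n) → dot (a +ᵥ b) v ≡ dot a v + dot b v
dot-+ˡ []      []      []      = refl
dot-+ˡ (a ∷ as) (b ∷ bs) (x ∷ xs) rewrite dot-+ˡ as bs xs = dot-+-step a b x _ _

dot--ˡ : ∀ {n} (a b v : Pt n) → dot (a -ᵥ b) v ≡ dot a v - dot b v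
dot--ˡ []      []      []      = refl
dot--ˡ (a ∷ as) (b ∷ bs) (x ∷ xs) rewrite dot--ˡ as bs xs = dot---step a b x _ _

dot-scaleˡ : ∀ {n} k (a v : Pt n) → dot (scale k a) v ≡ k * dot a v
dot-scaleˡ k []       []       = sym (ℤP.*-zeroʳ k)
dot-scaleˡ k (a ∷ as) (x ∷ xs) rewrite dot-scaleˡ k as xs = dot-scale-step k a x _

dot-zeroˡ : ∀ {n} (v : Pt n) → dot 0ᵥ v ≡ + 0
dot-zeroˡ []       = refl
dot-zeroˡ (x ∷ xs) = trans (ℤP.+-identityˡ _) (dot-zeroˡ xs)

dot-+ʳ : ∀ {n} (a u v : Pt n) → dot a (u +ᵥ v) ≡ dot a u + dot a v
dot-+ʳ a u v = trans (dot-comm a _) (trans (dot-+ˡ u v a) (cong₂ _+_ (dot-comm u a) (dot-comm v a)))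

dot--ʳ : ∀ {n} (a u v : Pt n) → dot a (u -ᵥ v) ≡ dot a u - dot a v
dot--ʳ a u v = trans (dot-comm a _) (trans (dot--ˡ u v a) (cong₂ _-_ (dot-comm u a) (dot-comm v a)))

dot-scaleʳ : ∀ {n} k (a v : Pt n) → dot a (scale k v) ≡ k * dot a v
dot-scaleʳ k a v = trans (dot-comm a _) (trans (dot-scaleˡ k v a) (cong (k *_) (dot-comm v a)))

dot-zeroʳ : ∀ {n} (a : Pt n) → dot a 0ᵥ ≡ + 0
dot-zeroʳ a = trans (dot-comm a _) (dot-zeroˡ a)

+ᵥ-identityˡ : ∀ {n} (v : Pt n) → 0ᵥ +ᵥ v ≡ v
+ᵥ-identityˡ []       = refl
+ᵥ-identityˡ (x ∷ xs) = cong₂ _∷_ (ℤP.+-identityˡ x) (+ᵥ-identityˡ xs)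

scale-0ᵥ : ∀ {n} k → scale k (0ᵥ {n}) ≡ 0ᵥ
scale-0ᵥ {zero}  k = refl
scale-0ᵥ {suc n} k = cong₂ _∷_ (ℤP.*-zeroʳ k) (scale-0ᵥ k)

-ᵥ-self : ∀ {n} (v : Pt n) → v -ᵥ v ≡ 0ᵥ
-ᵥ-self []       = refl
-ᵥ-self (x ∷ xs) = cong₂ _∷_ (ℤP.+-inverseʳ x) (-ᵥ-self xs)

Σv-head : ∀ {m n} (f : Fin m → ℤ) (g : Fin m → Pt n) → Σv (λ i → f i ∷ g i) ≡ Σℤ f ∷ Σv g
Σv-head {zero}  f g = refl
Σv-head {suc m} f g rewrite Σv-head (λ i → f (suc i)) (λ i → g (suc i)) = refl

Σℤ-dot : ∀ {m n} (b : Pt n) (f : Fin m → Pt n) → Σℤ (λ i → dot b (f i)) ≡ dot b (Σv f)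
Σℤ-dot {zero}  b f = sym (dot-zeroʳ b)
Σℤ-dot {suc m} b f = trans (cong (λ z → dot b (f zero) + z) (Σℤ-dot b (λ i → f (suc i)))) (sym (dot-+ʳ b _ _))

Σℤ-cong : ∀ {m} {f g : Fin m → ℤ} → (∀ i → f i ≡ g i) → Σℤ f ≡ Σℤ g
Σℤ-cong {zero}  e = refl
Σℤ-cong {suc m} e = cong₂ _+_ (e zero) (Σℤ-cong (λ i → e (suc i)))

-- Sums of rationals

Σℚ-cong : ∀ {m} {f g : Fin m → ℚ} → (∀ i → f i ≡ g i) → Σℚ f ≡ Σℚ g
Σℚ-cong {zero}  e = refl
Σℚ-cong {suc m} e = cong₂ ℚ._+_ (e zero) (Σℚ-cong (λ i → e (suc i)))

Σℚ-+ : ∀ {m} (f g : Fin m → ℚ) → Σℚ (λ i → f i ℚ.+ g i) ≡ Σℚ f ℚ.+ Σℚ g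
Σℚ-+ {zero}  f g = refl
Σℚ-+ {suc m} f g = begin
  (f₀ ℚ.+ g₀) ℚ.+ Σℚ (λ i → f (suc i) ℚ.+ g (suc i)) ≡⟨ cong ((f₀ ℚ.+ g₀) ℚ.+_) (Σℚ-+ (λ i → f (suc i)) (λ i → g (suc i))) ⟩
  (f₀ ℚ.+ g₀) ℚ.+ (F' ℚ.+ G')   ≡⟨ ℚP.+-assoc f₀ g₀ _ ⟩
  f₀ ℚ.+ (g₀ ℚ.+ (F' ℚ.+ G'))   ≡⟨ cong (f₀ ℚ.+_) (sym (ℚP.+-assoc g₀ F' G')) ⟩
  f₀ ℚ.+ ((g₀ ℚ.+ F') ℚ.+ G')   ≡⟨ cong (λ z → f₀ ℚ.+ (z ℚ.+ G')) (ℚP.+-comm g₀ F') ⟩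
  f₀ ℚ.+ ((F' ℚ.+ g₀) ℚ.+ G')   ≡⟨ cong (f₀ ℚ.+_) (ℚP.+-assoc F' g₀ G') ⟩
  f₀ ℚ.+ (F' ℚ.+ (g₀ ℚ.+ G'))   ≡⟨ sym (ℚP.+-assoc f₀ F' _) ⟩
  (f₀ ℚ.+ F') ℚ.+ (g₀ ℚ.+ G')   ∎
  where
  open ≡-Reasoning
  f₀ = f zero
  g₀ = g zero
  F' = Σℚ (λ i → f (suc i))
  G' = Σℚ (λ i → g (suc i))

Σℚ-*ˡ : ∀ {m} q (f : Fin m → ℚ) → Σℚ (λ i → q ℚ.* f i) ≡ q ℚ.* Σℚ f
Σℚ-*ˡ {zero}  q f = sym (ℚP.*-zeroʳ q)
Σℚ-*ˡ {suc m} q f = trans (cong (q ℚ.* f zero ℚ.+_) (Σℚ-*ˡ q (λ i → f (suc i)))) (sym (ℚP.*-distribˡ-+ q (f zero) _))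

Σℚ-zero : ∀ m → Σℚ {m} (λ _ → 0ℚ) ≡ 0ℚ
Σℚ-zero zero    = refl
Σℚ-zero (suc m) = trans (ℚP.+-identityˡ _) (Σℚ-zero m)

Σℚ-nonneg : ∀ {m} {f : Fin m → ℚ} → (∀ i → 0ℚ ℚ.≤ f i) → 0ℚ ℚ.≤ Σℚ f
Σℚ-nonneg {zero}  p = ℚP.≤-refl
Σℚ-nonneg {suc m} p = ℚP.+-mono-≤ (p zero) (Σℚ-nonneg (λ i → p (suc i)))

Σℚ-split : ∀ {m n} (f : Fin (m ℕ.+ n) → ℚ) →
           Σℚ f ≡ Σℚ {m} (λ i → f (i F.↑ˡ n)) ℚ.+ Σℚ {n} (λ i → f (m F.↑ʳ i))
Σℚ-split {zero}  f = sym (ℚP.+-identityˡ _)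
Σℚ-split {suc m} f = trans (cong (f zero ℚ.+_) (Σℚ-split {m} (λ i → f (suc i)))) (sym (ℚP.+-assoc (f zero) _ _))

-- The embedding `ι` of the integers in the rationals

private
  -- `ι z` is a normalised fraction. Replacing it by the unnormalised fraction over 1 turns
  -- arithmetic and order on the image of `ι` into statements about integers.
  toℚᵘ-ι : ∀ z → ℚ.toℚᵘ (ι z) ℚᵘ.≃ ℚᵘ.mkℚᵘ z 0
  toℚᵘ-ι z = ℚP.toℚᵘ-fromℚᵘ (ℚᵘ.mkℚᵘ z 0)

ι-+ : ∀ x y → ι (x + y) ≡ ι x ℚ.+ ι y
ι-+ x y = ℚP.toℚᵘ-injective (ℚᵘP.≃-trans (toℚᵘ-ι (x + y))
  (ℚᵘP.≃-trans (ℚᵘ.*≡* (lem x y))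
  (ℚᵘP.≃-sym (ℚᵘP.≃-trans (ℚP.toℚᵘ-homo-+ (ι x) (ι y)) (ℚᵘP.+-cong (toℚᵘ-ι x) (toℚᵘ-ι y))))))
  where
  lem : ∀ x y → (x + y) * + 1 ≡ (x * + 1 + y * + 1) * + 1
  lem = solve-∀

ι-* : ∀ x y → ι (x * y) ≡ ι x ℚ.* ι y
ι-* x y = ℚP.toℚᵘ-injective (ℚᵘP.≃-trans (toℚᵘ-ι (x * y))
  (ℚᵘP.≃-sym (ℚᵘP.≃-trans (ℚP.toℚᵘ-homo-* (ι x) (ι y)) (ℚᵘP.*-cong (toℚᵘ-ι x) (toℚᵘ-ι y)))))

ι-mono-≤ : ∀ {x y} → x ℤ.≤ y → ι x ℚ.≤ ι y
ι-mono-≤ {x} {y} p = ℚP.toℚᵘ-cancel-≤ (ℚᵘP.≤-respˡ-≃ (ℚᵘP.≃-sym (toℚᵘ-ι x))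
  (ℚᵘP.≤-respʳ-≃ (ℚᵘP.≃-sym (toℚᵘ-ι y)) (ℚᵘ.*≤* (ℤP.*-monoʳ-≤-nonNeg (+ 1) p))))

ι-mono-< : ∀ {x y} → x ℤ.< y → ι x ℚ.< ι y
ι-mono-< {x} {y} p = ℚP.toℚᵘ-cancel-< (ℚᵘP.<-respˡ-≃ (ℚᵘP.≃-sym (toℚᵘ-ι x))
  (ℚᵘP.<-respʳ-≃ (ℚᵘP.≃-sym (toℚᵘ-ι y)) (ℚᵘ.*<* (ℤP.*-monoʳ-<-pos (+ 1) p))))

ι-cancel-≤ : ∀ {x y} → ι x ℚ.≤ ι y → x ℤ.≤ y
ι-cancel-≤ p = ℤP.≮⇒≥ (λ q → ℚP.<-irrefl refl (ℚP.<-≤-trans (ι-mono-< q) p))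

ι-Σ : ∀ {m} (f : Fin m → ℤ) → ι (Σℤ f) ≡ Σℚ (λ i → ι (f i))
ι-Σ {zero}  f = refl
ι-Σ {suc m} f = trans (ι-+ (f zero) _) (cong (ι (f zero) ℚ.+_) (ι-Σ (λ i → f (suc i))))

ι-^ : ∀ x k → ι (x ℤ.^ k) ≡ powℚ (ι x) k
ι-^ x zero    = refl
ι-^ x (suc k) = trans (ι-* x (x ℤ.^ k)) (cong (ι x ℚ.*_) (ι-^ x k))

-- Faces of a prism

idx : ∀ {M} → Bool → Fin M → Fin (M ℕ.+ M)
idx {M} false j = j F.↑ˡ M
idx {M} true  j = M F.↑ʳ j

-- Matching on this view replaces a vertex of the prism by a facet (`false` for the bottom, `true`
-- for the top) and a vertex of the base.
data Idx {M} : Fin (M ℕ.+ M) → Set where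
  at : ∀ s (j : Fin M) → Idx (idx s j)

view : ∀ M (k : Fin (M ℕ.+ M)) → Idx k
view M k with splitAt M k in eq
... | inj₁ j = subst Idx (trans (cong (join M M) (sym eq)) (FP.join-splitAt M M k)) (at false j)
... | inj₂ j = subst Idx (trans (cong (join M M) (sym eq)) (FP.join-splitAt M M k)) (at true j)

splitAt-idx : ∀ {M} s (j : Fin M) → splitAt M (idx s j) ≡ (if s then inj₂ j else inj₁ j)
splitAt-idx {M} false j = FP.splitAt-↑ˡ M j M
splitAt-idx {M} true  j = FP.splitAt-↑ʳ M M j

idx-injective : ∀ {M} s s' {i j : Fin M} → idx s i ≡ idx s' j → s ≡ s' × i ≡ j
idx-injective {M} s s' {i} {j} e
  with s | s' | trans (sym (splitAt-idx s i)) (trans (cong (splitAt M) e) (splitAt-idx s' j))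
... | false | false | refl = refl , refl
... | true  | true  | refl = refl , refl

sameOrOpposite : ∀ s s' → s' ≡ s ⊎ s' ≡ not s
sameOrOpposite false false = inj₁ refl
sameOrOpposite false true  = inj₂ refl
sameOrOpposite true  false = inj₂ refl
sameOrOpposite true  true  = inj₁ refl

affine : ∀ {n} → ℤ → Pt n → Pt n → ℤ
affine h₀ α x = h₀ + dot α x

module _ {M n} (V : Fin M → Pt n) (h₀ : ℤ) (α : Pt n) where

  private
    h : Fin M → ℤ
    h j = affine h₀ α (V j)

  layer : Bool → Fin M → Pt (suc n)
  layer false j = + 0 ∷ V j
  layer true  j = h j ∷ V j

  prism : Fin (M ℕ.+ M) → Pt (suc n)
  prism k = [ layer false , layer true ]′ (splitAt M k)

  prism-idx : ∀ s j → prism (idx s j) ≡ layer s j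
  prism-idx false j rewrite FP.splitAt-↑ˡ M j M = refl
  prism-idx true  j rewrite FP.splitAt-↑ʳ M M j = refl

  -- The prism is the region between the facets y = η s + ⟨β s , x⟩, and σ s is
  -- the direction from the facet s into the prism.
  η σ : Bool → ℤ
  η false = + 0
  η true  = h₀
  σ false = + 1
  σ true  = - + 1

  β : Bool → Pt n
  β false = 0ᵥ
  β true  = α

  -- One formula for both layers lets most later arguments treat the two facets at once, with `s` as
  -- a parameter.
  layer-β : ∀ s j → layer s j ≡ (η s + dot (β s) (V j)) ∷ V j
  layer-β false j = cong (_∷ V j) (sym (trans (ℤP.+-identityˡ _) (dot-zeroˡ (V j))))
  layer-β true  j = refl

  module _ (h>0 : ∀ j → + 0 ℤ.< h j) where

    σ-gap : ∀ s j → η (not s) + dot (β (not s)) (V j) ≡ (η s + dot (β s) (V j)) + σ s * h j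
    σ-gap false j rewrite dot-zeroˡ (V j) = lem (h j)
      where
      lem : ∀ x → x ≡ (+ 0 + + 0) + + 1 * x
      lem = solve-∀
    σ-gap true  j rewrite dot-zeroˡ (V j) = lem (h j)
      where
      lem : ∀ x → + 0 + + 0 ≡ x + - + 1 * x
      lem = solve-∀

    σ² : ∀ s → σ s * σ s ≡ + 1
    σ² false = refl
    σ² true  = refl

    -- The functional on the prism that is a on the facet s, up to a constant, and
    -- decreases in the direction σ s.
    lift : Bool → Pt n → Pt (suc n)
    lift s a = (- σ s) ∷ (a +ᵥ scale (σ s) (β s))

    -- The slope of the facet cancels: the height coordinate contributes `- σ s * dot (β s) (V j)`,
    -- and the second summand in `lift` contributes the opposite.
    lift-same : ∀ s a j → dot (lift s a) (prism (idx s j)) ≡ dot a (V j) - σ s * η s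
    lift-same s a j
      rewrite prism-idx s j | layer-β s j | dot-+ˡ a (scale (σ s) (β s)) (V j) | dot-scaleˡ (σ s) (β s) (V j)
      = lem (σ s) (η s) (dot (β s) (V j)) (dot a (V j))
      where
      lem : ∀ σ η b a → (- σ) * (η + b) + (a + σ * b) ≡ a - σ * η
      lem = solve-∀

    -- Crossing to the other facet adds `σ s * h j` to the height. The coefficient `- σ s` turns
    -- this into a drop by `h j`, because `σ s * σ s` is 1.
    lift-opposite : ∀ s a j → dot (lift s a) (prism (idx (not s) j)) ≡ dot a (V j) - σ s * η s - h j
    lift-opposite s a j
      rewrite prism-idx (not s) j | layer-β (not s) j | σ-gap s j
            | dot-+ˡ a (scale (σ s) (β s)) (V j) | dot-scaleˡ (σ s) (β s) (V j)
      = trans (lem (σ s) (η s) (dot (β s) (V j)) (dot a (V j)) (h j))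
              (trans (cong (λ z → dot a (V j) - σ s * η s - z * h j) (σ² s))
              (cong (λ z → dot a (V j) - σ s * η s - z) (ℤP.*-identityˡ (h j))))
      where
      lem : ∀ σ η b a h → (- σ) * ((η + b) + σ * h) + (a + σ * b) ≡ a - σ * η - σ * σ * h
      lem = solve-∀

    lift-same-< : ∀ s a i j → dot a (V j) ℤ.< dot a (V i) →
                  dot (lift s a) (prism (idx s j)) ℤ.< dot (lift s a) (prism (idx s i))
    lift-same-< s a i j p = subst₂ ℤ._<_ (sym (lift-same s a j)) (sym (lift-same s a i)) (ℤP.+-monoˡ-< _ p)

    -- Positivity of `h` supplies the strictness, so a tie on the base is allowed. This covers the
    -- vertex across the vertical edge, where `j` is `i`.
    lift-opposite-< : ∀ s a i j → dot a (V j) ℤ.≤ dot a (V i) →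
                      dot (lift s a) (prism (idx (not s) j)) ℤ.< dot (lift s a) (prism (idx s i))
    lift-opposite-< s a i j p = subst₂ ℤ._<_ (sym (lift-opposite s a j)) (trans (ℤP.+-identityʳ _) (sym (lift-same s a i)))
      (ℤP.+-mono-≤-< (ℤP.+-monoˡ-≤ _ p) (ℤP.neg-mono-< (h>0 j)))

    vertical : ∀ s a j → dot (+ 0 ∷ a) (prism (idx s j)) ≡ dot a (V j)
    vertical false a j rewrite prism-idx false j = ℤP.+-identityˡ _
    vertical true  a j rewrite prism-idx true  j = ℤP.+-identityˡ _

    -- The functional on P that restricts b from the facet s, up to a constant.
    restrict : Bool → Pt (suc n) → Pt n
    restrict s (b ∷ a) = a +ᵥ scale b (β s)

    restrict-dot : ∀ s b j → dot b (prism (idx s j)) ≡ dot (restrict s b) (V j) + head b * η s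
    restrict-dot s (b ∷ a) j
      rewrite prism-idx s j | layer-β s j | dot-+ˡ a (scale b (β s)) (V j) | dot-scaleˡ b (β s) (V j)
      = lem b (η s) (dot (β s) (V j)) (dot a (V j))
      where
      lem : ∀ b η x a → b * (η + x) + a ≡ a + b * x + b * η
      lem = solve-∀

    -- As `h j` is positive, the sign of `σ s * head b` decides whether `b` grows from the facet `s`
    -- to the opposite one, and this sign is the same over every vertex `j`.
    climb : ∀ s b j → dot b (prism (idx (not s) j)) ≡ dot b (prism (idx s j)) + (σ s * head b) * h j
    climb s (b ∷ a) j
      rewrite prism-idx s j | prism-idx (not s) j | layer-β s j | layer-β (not s) j | σ-gap s j
      = lem b (η s + dot (β s) (V j)) (σ s) (h j) (dot a (V j))
      where
      lem : ∀ b x σ h a → b * (x + σ * h) + a ≡ b * x + a + (σ * b) * h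
      lem = solve-∀

    -- Vertices and dimension of a prism

    prism-vertex : (∀ i → IsVertex V i) → ∀ k → IsVertex prism k
    prism-vertex vert k with view M k
    ... | at s i with vert i
    ... | a , a-max = lift s a , strict
      where
      weak : ∀ j → dot a (V j) ℤ.≤ dot a (V i)
      weak j with j FP.≟ i
      ... | yes refl = ℤP.≤-refl
      ... | no  j≢i  = ℤP.<⇒≤ (a-max j j≢i)
      strict : ∀ k → k ≢ idx s i → dot (lift s a) (prism k) ℤ.< dot (lift s a) (prism (idx s i))
      strict k k≢ with view M k
      ... | at s' j with sameOrOpposite s s'
      ... | inj₁ refl = lift-same-< s a i j (a-max j (λ e → k≢ (cong (idx s) e)))
      ... | inj₂ refl = lift-opposite-< s a i j (weak j)

    -- A functional that is constant on the prism has no climb over the vertex `i`. Since `h i` is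
    -- not zero, its height coefficient is, and what remains is a constant functional on the bottom
    -- facet, a copy of P.
    prism-fullDim : Fin M → FullDim V → FullDim prism
    prism-fullDim i full (b ∷ a) const = cong₂ _∷_ b≡0 (full a a-const)
      where
      cancel : ∀ x y → x + y ≡ x → y ≡ + 0
      cancel x y e = trans (lem x y) (trans (cong (_- x) e) (ℤP.+-inverseʳ x))
        where
        lem : ∀ x y → y ≡ x + y - x
        lem = solve-∀
      gap≡0 : + 1 * b * h i ≡ + 0
      gap≡0 = cancel (dot (b ∷ a) (prism (idx false i))) (+ 1 * b * h i)
                (trans (sym (climb false (b ∷ a) i)) (const (idx true i) (idx false i)))
      b≡0 : b ≡ + 0
      b≡0 with ℤP.i*j≡0⇒i≡0∨j≡0 (+ 1 * b) gap≡0
      ... | inj₁ e = trans (sym (ℤP.*-identityˡ b)) e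
      ... | inj₂ e = contradiction (sym e) (ℤP.<⇒≢ (h>0 i))
      bottom : ∀ j → dot (b ∷ a) (prism (idx false j)) ≡ dot a (V j)
      bottom j rewrite prism-idx false j = trans (cong (_+ dot a (V j)) (ℤP.*-zeroʳ b)) (ℤP.+-identityˡ _)
      a-const : ∀ j k → dot a (V j) ≡ dot a (V k)
      a-const j k = trans (sym (bottom j)) (trans (const (idx false j) (idx false k)) (bottom k))

    -- Edges of a prism

    verticalEdge : (∀ i → IsVertex V i) → ∀ s i → Edge prism (idx s i) (idx (not s) i)
    verticalEdge vert s i with vert i
    ... | a , a-max = (λ e → 𝔹.not-¬ refl (proj₁ (idx-injective s (not s) e)))
                    -- The functional exposing `V i` in P, made to ignore the height, is maximal
                    -- exactly on the fibre over `V i`, whose endpoints are the two vertices.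
                    , (+ 0 ∷ a) , trans (vertical s a i) (sym (vertical (not s) a i)) , strict
      where
      strict : ∀ k → k ≢ idx s i → k ≢ idx (not s) i → dot (+ 0 ∷ a) (prism k) ℤ.< dot (+ 0 ∷ a) (prism (idx s i))
      strict k k≢ k≢' with view M k
      ... | at s' j = subst₂ ℤ._<_ (sym (vertical s' a j)) (sym (vertical s a i)) (a-max j j≢i)
        where
        j≢i : j ≢ i
        j≢i refl with sameOrOpposite s s'
        ... | inj₁ refl = k≢ refl
        ... | inj₂ refl = k≢' refl

    horizontalEdge : ∀ s i j → Edge V i j → Edge prism (idx s i) (idx s j)
    horizontalEdge s i j (i≢j , a , ai≡aj , a-max) =
        (λ e → i≢j (proj₂ (idx-injective s s e)))
      , lift s a
      , trans (lift-same s a i) (trans (cong (_- σ s * η s) ai≡aj) (sym (lift-same s a j)))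
      , strict
      where
      weak : ∀ k → dot a (V k) ℤ.≤ dot a (V i)
      weak k with k FP.≟ i | k FP.≟ j
      ... | yes refl | _        = ℤP.≤-refl
      ... | no _     | yes refl = ℤP.≤-reflexive (sym ai≡aj)
      ... | no k≢i   | no k≢j   = ℤP.<⇒≤ (a-max k k≢i k≢j)
      strict : ∀ k → k ≢ idx s i → k ≢ idx s j → dot (lift s a) (prism k) ℤ.< dot (lift s a) (prism (idx s i))
      strict k k≢i k≢j with view M k
      ... | at s' l with sameOrOpposite s s'
      ... | inj₁ refl = lift-same-< s a i l (a-max l (λ e → k≢i (cong (idx s) e)) (λ e → k≢j (cong (idx s) e)))
      ... | inj₂ refl = lift-opposite-< s a i l (weak l)

    -- An edge between (s , i) and (not s , j) with j ≢ i would be the maximal face of a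
    -- functional that increases from the facet s at j but decreases at i.
    edge-cases : ∀ s i s' j → Edge prism (idx s i) (idx s' j) →
                 (s' ≡ s × Edge V i j) ⊎ (s' ≡ not s × j ≡ i)
    edge-cases s i s' j (i≢j , b , bi≡bj , b-max) with sameOrOpposite s s'
    -- Within one facet, `b` and `restrict s b` differ by a constant, so the functional of an edge
    -- of the prism gives that of an edge of P.
    ... | inj₁ refl = inj₁ (refl , (λ e → i≢j (cong (idx s) e)) , restrict s b , a-eq , a-max)
      where
      cancel : ∀ {x y} c → x + c ≡ y + c → x ≡ y
      cancel {x} {y} c e = trans (lem x c) (trans (cong (_- c) e) (sym (lem y c)))
        where
        lem : ∀ x c → x ≡ x + c - c
        lem = solve-∀
      cancel-< : ∀ {x y} c → x + c ℤ.< y + c → x ℤ.< y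
      cancel-< {x} {y} c p = subst₂ ℤ._<_ (lem x c) (lem y c) (ℤP.+-monoˡ-< (- c) p)
        where
        lem : ∀ x c → x + c + - c ≡ x
        lem = solve-∀
      a-eq : dot (restrict s b) (V i) ≡ dot (restrict s b) (V j)
      a-eq = cancel _ (trans (sym (restrict-dot s b i)) (trans bi≡bj (restrict-dot s b j)))
      a-max : ∀ k → k ≢ i → k ≢ j → dot (restrict s b) (V k) ℤ.< dot (restrict s b) (V i)
      a-max k k≢i k≢j = cancel-< _ (subst₂ ℤ._<_ (restrict-dot s b k) (restrict-dot s b i)
        (b-max (idx s k) (λ e → k≢i (proj₂ (idx-injective s s e))) (λ e → k≢j (proj₂ (idx-injective s s e)))))
    ... | inj₂ refl with j FP.≟ i
    ... | yes j≡i = inj₂ (refl , j≡i)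
    ... | no  j≢i = contradiction (ℤP.<-trans x<0 0<x) (ℤP.<-irrefl refl)
      where
      x : ℤ
      x = σ s * head b
      h⁺ : ∀ k → ℤ.NonNegative (h k)
      h⁺ k = ℤ.nonNegative (ℤP.<⇒≤ (h>0 k))
      lem : ∀ u v → - u + (u + v) ≡ v
      lem = solve-∀
      x<0 : x ℤ.< + 0
      x<0 = ℤP.*-cancelʳ-<-nonNeg (h i) {{h⁺ i}} (subst₂ ℤ._<_ (trans (cong (λ z → - u + z) (climb s b i)) (lem u _)) (ℤP.+-inverseˡ u)
        (ℤP.+-monoʳ-< (- u) (b-max (idx (not s) i)
          (λ e → 𝔹.not-¬ refl (sym (proj₁ (idx-injective (not s) s e))))
          (λ e → j≢i (sym (proj₂ (idx-injective (not s) (not s) e)))))))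
        where
        u : ℤ
        u = dot b (prism (idx s i))
      0<x : + 0 ℤ.< x
      0<x = ℤP.*-cancelʳ-<-nonNeg (h j) {{h⁺ j}} (subst₂ ℤ._<_ (ℤP.+-inverseˡ u) (trans (cong (λ z → - u + z) (trans bi≡bj (climb s b j))) (lem u _))
        (ℤP.+-monoʳ-< (- u) (b-max (idx s j)
          (λ e → j≢i (proj₂ (idx-injective s s e)))
          (λ e → 𝔹.not-¬ refl (proj₁ (idx-injective s (not s) e))))))
        where
        u : ℤ
        u = dot b (prism (idx s j))

    -- Edge directions and smoothness of a prism

    dir : Bool → (Fin n → Pt n) → Fin (suc n) → Pt (suc n)
    dir s d zero    = σ s ∷ 0ᵥ
    dir s d (suc k) = dot (β s) (d k) ∷ d k

    verticalDir : ∀ s i → PrimEdgeDir (prism (idx s i)) (prism (idx (not s) i)) (σ s ∷ 0ᵥ)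
    verticalDir s i = (λ g g∣ → ℕD.∣1⇒≡1 (subst (g ℕD.∣_) (∣σ∣ s) (g∣ zero))) , ∣ h i ∣ , eq
      where
      ∣σ∣ : ∀ s → ∣ σ s ∣ ≡ 1
      ∣σ∣ false = refl
      ∣σ∣ true  = refl
      lem : ∀ x σ h → x + σ * h - x ≡ h * σ
      lem = solve-∀
      eq : prism (idx (not s) i) -ᵥ prism (idx s i) ≡ scale (+ ∣ h i ∣) (σ s ∷ 0ᵥ)
      eq = trans (cong₂ _-ᵥ_ (trans (prism-idx (not s) i) (trans (layer-β (not s) i) (cong (_∷ V i) (σ-gap s i))))
                             (trans (prism-idx s i) (layer-β s i)))
             (trans (cong₂ _∷_ (lem (η s + dot (β s) (V i)) (σ s) (h i)) (trans (-ᵥ-self (V i)) (sym (scale-0ᵥ (h i)))))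
               (cong (λ k → scale k (σ s ∷ 0ᵥ)) (sym (ℤP.0≤i⇒+∣i∣≡i (ℤP.<⇒≤ (h>0 i))))))

    -- The facet is the graph of an affine function, so a direction of P is raised by its linear
    -- part `β s`. Primitivity survives because the entries of `d` remain among the entries.
    horizontalDir : ∀ s i j d → PrimEdgeDir (V i) (V j) d →
                    PrimEdgeDir (prism (idx s i)) (prism (idx s j)) (dot (β s) d ∷ d)
    horizontalDir s i j d (prim , k , Vj-Vi≡kd) = (λ g g∣ → prim g (λ l → g∣ (suc l))) , k , eq
      where
      lem : ∀ e x y → (e + x) - (e + y) ≡ x - y
      lem = solve-∀
      eq : prism (idx s j) -ᵥ prism (idx s i) ≡ scale (+ k) (dot (β s) d ∷ d)
      eq rewrite prism-idx s i | prism-idx s j | layer-β s i | layer-β s j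
        = cong₂ _∷_
            (trans (lem (η s) _ _) (trans (sym (dot--ʳ (β s) (V j) (V i)))
              (trans (cong (dot (β s)) Vj-Vi≡kd) (dot-scaleʳ (+ k) (β s) d))))
            Vj-Vi≡kd

    -- The directions form a block triangular matrix: the vertical one affects the first coordinate
    -- only, and the others restrict to the directions of P.
    lincomb-dir : ∀ s c d → lincomb c (dir s d) ≡
      (c zero * σ s + dot (β s) (lincomb (c ∘ suc) d)) ∷ lincomb (c ∘ suc) d
    lincomb-dir s c d = begin
      scale (c zero) (σ s ∷ 0ᵥ) +ᵥ Σv (λ k → (c (suc k) * dot (β s) (d k)) ∷ scale (c (suc k)) (d k))
        ≡⟨ cong₂ _+ᵥ_ (cong (c zero * σ s ∷_) (scale-0ᵥ (c zero))) (Σv-head (λ k → c (suc k) * dot (β s) (d k)) _) ⟩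
      (c zero * σ s + Σℤ (λ k → c (suc k) * dot (β s) (d k))) ∷ (0ᵥ +ᵥ lincomb (c ∘ suc) d)
        ≡⟨ cong₂ (λ x v → (c zero * σ s + x) ∷ v)
             (trans (Σℤ-cong (λ k → sym (dot-scaleʳ (c (suc k)) (β s) (d k)))) (Σℤ-dot (β s) (λ k → scale (c (suc k)) (d k))))
             (+ᵥ-identityˡ _) ⟩
      (c zero * σ s + dot (β s) (lincomb (c ∘ suc) d)) ∷ lincomb (c ∘ suc) d ∎
      where open ≡-Reasoning

    -- The diagonal blocks are the unit `σ s` and a lattice basis, so the triangular matrix is
    -- invertible over the integers.
    dir-basis : ∀ s d → IsLatticeBasis d → IsLatticeBasis (dir s d)
    dir-basis s d (span , indep) = span′ , indep′
      where
      span′ : ∀ z → ∃ λ c → z ≡ lincomb c (dir s d)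
      span′ (z₀ ∷ z) with span z
      ... | c , z≡ = c′ , sym (trans (lincomb-dir s c′ d) (cong₂ _∷_ head≡ (sym z≡)))
        where
        c′ : Fin (suc n) → ℤ
        -- The solution of the equation for the first coordinate, in which division by `σ s` is
        -- multiplication by `σ s`.
        c′ zero    = σ s * (z₀ - dot (β s) z)
        c′ (suc k) = c k
        lem : ∀ σ z b → σ * (z - b) * σ + b ≡ σ * σ * (z - b) + b
        lem = solve-∀
        lem′ : ∀ z b → + 1 * (z - b) + b ≡ z
        lem′ = solve-∀
        head≡ : c′ zero * σ s + dot (β s) (lincomb c d) ≡ z₀
        head≡ = trans (cong (λ v → c′ zero * σ s + dot (β s) v) (sym z≡))
          (trans (lem (σ s) z₀ (dot (β s) z)) (trans (cong (λ x → x * (z₀ - dot (β s) z) + dot (β s) z) (σ² s)) (lem′ z₀ _)))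
      indep′ : ∀ c → lincomb c (dir s d) ≡ 0ᵥ → ∀ i → c i ≡ + 0
      indep′ c e = coeff
        where
        e′ : (c zero * σ s + dot (β s) (lincomb (c ∘ suc) d)) ∷ lincomb (c ∘ suc) d ≡ 0ᵥ
        e′ = trans (sym (lincomb-dir s c d)) e
        c₀σ : c zero * σ s ≡ + 0
        c₀σ = trans (sym (ℤP.+-identityʳ _)) (trans
          (cong (λ x → c zero * σ s + x) (sym (trans (cong (dot (β s)) (VP.∷-injectiveʳ e′)) (dot-zeroʳ (β s)))))
          (VP.∷-injectiveˡ e′))
        coeff : ∀ i → c i ≡ + 0
        coeff zero    = trans (sym (ℤP.*-identityʳ (c zero))) (trans (cong (c zero *_) (sym (σ² s)))
          (trans (sym (ℤP.*-assoc (c zero) (σ s) (σ s))) (cong (_* σ s) c₀σ)))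
        coeff (suc k) = indep (c ∘ suc) (VP.∷-injectiveʳ e′) k

    -- The neighbours are the vertex across the vertical edge and the neighbours of `i` within the
    -- same facet; `edge-cases` shows that there are no others.
    prism-smooth : (∀ i → IsVertex V i) → Smooth V → Smooth prism
    prism-smooth vert smooth k with view M k
    ... | at s i with smooth i
    ... | nb , nb-inj , nb-edge , nb-all , d , nb-dir , basis =
      nb′ , nb′-inj , nb′-edge , nb′-all , dir s d , nb′-dir , dir-basis s d basis
      where
      nb′ : Fin (suc n) → Fin (M ℕ.+ M)
      nb′ zero    = idx (not s) i
      nb′ (suc k) = idx s (nb k)
      nb′-inj : Injective _≡_ _≡_ nb′
      nb′-inj {zero}  {zero}  e = refl
      nb′-inj {zero}  {suc l} e = contradiction (sym (proj₁ (idx-injective (not s) s e))) (𝔹.not-¬ refl)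
      nb′-inj {suc k} {zero}  e = contradiction (proj₁ (idx-injective s (not s) e)) (𝔹.not-¬ refl)
      nb′-inj {suc k} {suc l} e = cong suc (nb-inj (proj₂ (idx-injective s s e)))
      nb′-edge : ∀ k → Edge prism (idx s i) (nb′ k)
      nb′-edge zero    = verticalEdge vert s i
      nb′-edge (suc k) = horizontalEdge s i (nb k) (nb-edge k)
      nb′-all : ∀ j → Edge prism (idx s i) j → ∃ λ k → nb′ k ≡ j
      nb′-all j edge with view M j
      ... | at s′ j′ with edge-cases s i s′ j′ edge
      ... | inj₂ (refl , refl) = zero , refl
      ... | inj₁ (refl , edge′) with nb-all j′ edge′
      ... | k , refl = suc k , refl
      nb′-dir : ∀ k → PrimEdgeDir (prism (idx s i)) (prism (nb′ k)) (dir s d k)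
      nb′-dir zero    = verticalDir s i
      nb′-dir (suc k) = horizontalDir s i (nb k) (d k) (nb-dir k)

-- Dilates of a prism

Combines : ∀ {M n} → (Fin M → ℚ) → ℤ → (Fin M → Pt n) → Pt n → Set
Combines w t V x = ∀ k → Σℚ (λ i → w i ℚ.* ι (t * lookup (V i) k)) ≡ ι (lookup x k)

-- Weights that represent `x` coordinatewise represent the value at `x` of every linear functional,
-- by induction on the number of coordinates.
Combines-dot : ∀ {M n} (w : Fin M → ℚ) t (V : Fin M → Pt n) x α → Combines w t V x →
               Σℚ (λ i → w i ℚ.* ι (t * dot α (V i))) ≡ ι (dot α x)
Combines-dot {M} w t V [] [] comb =
  trans (Σℚ-cong (λ i → trans (cong (λ z → w i ℚ.* ι z) (empty (V i))) (ℚP.*-zeroʳ (w i)))) (Σℚ-zero M)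
  where
  empty : ∀ v → t * dot [] v ≡ + 0
  empty [] = ℤP.*-zeroʳ t
Combines-dot {M} w t V (x₀ ∷ x) (a ∷ α) comb = begin
  Σℚ (λ i → w i ℚ.* ι (t * dot (a ∷ α) (V i)))
    ≡⟨ Σℚ-cong (λ i → split (w i) (V i)) ⟩
  Σℚ (λ i → ι a ℚ.* (w i ℚ.* ι (t * lookup (V i) zero)) ℚ.+ w i ℚ.* ι (t * dot α (tail (V i))))
    ≡⟨ Σℚ-+ (λ i → ι a ℚ.* (w i ℚ.* ι (t * lookup (V i) zero))) (λ i → w i ℚ.* ι (t * dot α (tail (V i)))) ⟩
  Σℚ (λ i → ι a ℚ.* (w i ℚ.* ι (t * lookup (V i) zero))) ℚ.+ Σℚ (λ i → w i ℚ.* ι (t * dot α (tail (V i))))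
    ≡⟨ cong₂ ℚ._+_ (trans (Σℚ-*ˡ (ι a) (λ i → w i ℚ.* ι (t * lookup (V i) zero))) (trans (cong (ι a ℚ.*_) (comb zero)) (sym (ι-* a x₀))))
                   (Combines-dot w t (tail ∘ V) x α (λ k → trans (Σℚ-cong (λ i → cong (λ z → w i ℚ.* ι (t * z)) (lookup-tail (V i) k))) (comb (suc k)))) ⟩
  ι (a * x₀) ℚ.+ ι (dot α x)
    ≡⟨ sym (ι-+ (a * x₀) (dot α x)) ⟩
  ι (a * x₀ + dot α x) ∎
  where
  open ≡-Reasoning
  lookup-tail : ∀ {n} (v : Pt (suc n)) k → lookup (tail v) k ≡ lookup v (suc k)
  lookup-tail (_ ∷ _) k = refl
  lem : ∀ t a l d → t * (a * l + d) ≡ a * (t * l) + t * d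
  lem = solve-∀
  split : ∀ q v → q ℚ.* ι (t * dot (a ∷ α) v) ≡
                  ι a ℚ.* (q ℚ.* ι (t * lookup v zero)) ℚ.+ q ℚ.* ι (t * dot α (tail v))
  split q (l ∷ v) = begin
    q ℚ.* ι (t * (a * l + dot α v))                             ≡⟨ cong (λ z → q ℚ.* ι z) (lem t a l (dot α v)) ⟩
    q ℚ.* ι (a * (t * l) + t * dot α v)                         ≡⟨ cong (q ℚ.*_) (trans (ι-+ (a * (t * l)) (t * dot α v)) (cong (ℚ._+ ι (t * dot α v)) (ι-* a (t * l)))) ⟩
    q ℚ.* (ι a ℚ.* ι (t * l) ℚ.+ ι (t * dot α v))               ≡⟨ ℚP.*-distribˡ-+ q _ _ ⟩
    q ℚ.* (ι a ℚ.* ι (t * l)) ℚ.+ q ℚ.* ι (t * dot α v)         ≡⟨ cong (ℚ._+ q ℚ.* ι (t * dot α v)) (swap q (ι a) (ι (t * l))) ⟩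
    ι a ℚ.* (q ℚ.* ι (t * l)) ℚ.+ q ℚ.* ι (t * dot α v)         ∎
    where
    swap : ∀ p q r → p ℚ.* (q ℚ.* r) ≡ q ℚ.* (p ℚ.* r)
    swap p q r = trans (sym (ℚP.*-assoc p q r)) (trans (cong (ℚ._* r) (ℚP.*-comm p q)) (ℚP.*-assoc q p r))

-- Because the weights sum to 1, the constant term averages to `t * h₀`. Thus the height function of
-- the dilated prism has constant term `t * h₀` and unchanged linear part.
Combines-affine : ∀ {M n} (w : Fin M → ℚ) t (V : Fin M → Pt n) x h₀ α → Σℚ w ≡ 1ℚ → Combines w t V x →
                  Σℚ (λ i → w i ℚ.* ι (t * affine h₀ α (V i))) ≡ ι (affine (t * h₀) α x)
Combines-affine w t V x h₀ α Σw≡1 comb = begin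
  Σℚ (λ i → w i ℚ.* ι (t * (h₀ + dot α (V i))))
    ≡⟨ Σℚ-cong (λ i → split (w i) (dot α (V i))) ⟩
  Σℚ (λ i → ι (t * h₀) ℚ.* w i ℚ.+ w i ℚ.* ι (t * dot α (V i)))
    ≡⟨ Σℚ-+ (λ i → ι (t * h₀) ℚ.* w i) (λ i → w i ℚ.* ι (t * dot α (V i))) ⟩
  Σℚ (λ i → ι (t * h₀) ℚ.* w i) ℚ.+ Σℚ (λ i → w i ℚ.* ι (t * dot α (V i)))
    ≡⟨ cong₂ ℚ._+_ (trans (Σℚ-*ˡ (ι (t * h₀)) w) (trans (cong (ι (t * h₀) ℚ.*_) Σw≡1) (ℚP.*-identityʳ (ι (t * h₀)))))
                   (Combines-dot w t V x α comb) ⟩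
  ι (t * h₀) ℚ.+ ι (dot α x)
    ≡⟨ sym (ι-+ (t * h₀) (dot α x)) ⟩
  ι (t * h₀ + dot α x) ∎
  where
  open ≡-Reasoning
  split : ∀ q d → q ℚ.* ι (t * (h₀ + d)) ≡ ι (t * h₀) ℚ.* q ℚ.+ q ℚ.* ι (t * d)
  split q d = trans (cong (λ z → q ℚ.* ι z) (ℤP.*-distribˡ-+ t h₀ d))
    (trans (cong (q ℚ.*_) (ι-+ (t * h₀) (t * d))) (trans (ℚP.*-distribˡ-+ q _ _)
      (cong (ℚ._+ q ℚ.* ι (t * d)) (ℚP.*-comm q (ι (t * h₀))))))

*-nonneg : ∀ {p q} → 0ℚ ℚ.≤ p → 0ℚ ℚ.≤ q → 0ℚ ℚ.≤ p ℚ.* q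
*-nonneg {p} {q} 0≤p 0≤q = ℚP.nonNegative⁻¹ _ {{ℚP.nonNeg*nonNeg⇒nonNeg p {{ℚ.nonNegative 0≤p}} q {{ℚ.nonNegative 0≤q}}}}

fraction : ∀ y H → + 0 ℤ.≤ y → y ℤ.≤ H → ∃ λ s → 0ℚ ℚ.≤ s × s ℚ.≤ 1ℚ × s ℚ.* ι H ≡ ι y
fraction y H 0≤y y≤H with + 0 ℤP.<? H
-- Here `y` and `H` are both 0, and any proportion would do; 0 is the default. This happens for the
-- dilate with `t = 0`.
... | no  0≮H = 0ℚ , ℚP.≤-refl , ι-mono-≤ {+ 0} {+ 1} (ℤ.+≤+ ℕ.z≤n)
              , trans (ℚP.*-zeroˡ (ι H)) (cong ι (ℤP.≤-antisym 0≤y (ℤP.≤-trans y≤H (ℤP.≮⇒≥ 0≮H))))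
... | yes 0<H = s , 0≤s , s≤1 , sH≡y
  where
  instance
    H⁺ : ℚ.Positive (ι H)
    H⁺ = ℚ.positive (ι-mono-< 0<H)
    H≢0 : ℚ.NonZero (ι H)
    H≢0 = ℚP.pos⇒nonZero (ι H)
  s : ℚ
  s = ι y ℚ.* ℚ.1/ ι H
  sH≡y : s ℚ.* ι H ≡ ι y
  sH≡y = trans (ℚP.*-assoc (ι y) _ _) (trans (cong (ι y ℚ.*_) (ℚP.*-inverseˡ (ι H))) (ℚP.*-identityʳ _))
  0≤s : 0ℚ ℚ.≤ s
  0≤s = ℚP.*-cancelʳ-≤-pos (ι H) (subst₂ ℚ._≤_ (sym (ℚP.*-zeroˡ (ι H))) (sym sH≡y) (ι-mono-≤ 0≤y))
  s≤1 : s ℚ.≤ 1ℚ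
  s≤1 = ℚP.*-cancelʳ-≤-pos (ι H) (subst₂ ℚ._≤_ (sym sH≡y) (sym (ℚP.*-identityˡ (ι H))) (ι-mono-≤ y≤H))

Σℚ-idx : ∀ {M} (f : Fin (M ℕ.+ M) → ℚ) → Σℚ f ≡ Σℚ (λ i → f (idx {M} false i)) ℚ.+ Σℚ (λ i → f (idx {M} true i))
Σℚ-idx {M} f = Σℚ-split {M} f

module _ {M n} (V : Fin M → Pt n) (h₀ : ℤ) (α : Pt n) (h>0 : ∀ j → + 0 ℤ.< affine h₀ α (V j)) (t : ℕ) where

  private
    h : Fin M → ℤ
    h j = affine h₀ α (V j)

    0≤th : ∀ j → 0ℚ ℚ.≤ ι (+ t * h j)
    0≤th j = ι-mono-≤ (subst (ℤ._≤ + t * h j) (ℤP.*-zeroʳ (+ t)) (ℤP.*-monoˡ-≤-nonNeg (+ t) (ℤP.<⇒≤ (h>0 j))))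

  -- The height over `x` is an average of the nonnegative numbers `t * h j`, taken with the weights
  -- of `x`.
  height-nonneg : ∀ x → InDilate V t x → + 0 ℤ.≤ affine (+ t * h₀) α x
  height-nonneg x (w , w≥0 , Σw≡1 , comb) = ι-cancel-≤ (subst (0ℚ ℚ.≤_) (Combines-affine w (+ t) V x h₀ α Σw≡1 comb)
    (Σℚ-nonneg (λ i → *-nonneg (w≥0 i) (0≤th i))))

  -- Adding the weights of the two copies of each vertex gives weights for `x`. The weights of the
  -- top copies alone produce `y`, which is therefore nonnegative and at most the full height.
  prism-dilate⁻ : ∀ y x → InDilate (prism V h₀ α) t (y ∷ x) →
                  InDilate V t x × + 0 ℤ.≤ y × y ℤ.≤ affine (+ t * h₀) α x
  prism-dilate⁻ y x (w , w≥0 , Σw≡1 , comb) =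
      (u , u≥0 , Σu≡1 , comb-u)
    , ι-cancel-≤ (subst (0ℚ ℚ.≤_) ιy (Σℚ-nonneg (λ i → *-nonneg (w≥0 (idx true i)) (0≤th i))))
    , ι-cancel-≤ (subst₂ ℚ._≤_ ιy (Combines-affine u (+ t) V x h₀ α Σu≡1 comb-u) top≤)
    where
    w₀ w₁ u : Fin M → ℚ
    w₀ i = w (idx false i)
    w₁ i = w (idx true i)
    u  i = w₀ i ℚ.+ w₁ i
    u≥0 : ∀ i → 0ℚ ℚ.≤ u i
    u≥0 i = ℚP.+-mono-≤ (w≥0 (idx false i)) (w≥0 (idx true i))
    Σu≡1 : Σℚ u ≡ 1ℚ
    Σu≡1 = trans (Σℚ-+ w₀ w₁) (trans (sym (Σℚ-idx {M} w)) Σw≡1)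
    Σu : ∀ (g : Fin M → ℚ) → Σℚ (λ i → u i ℚ.* g i) ≡ Σℚ (λ i → w₀ i ℚ.* g i) ℚ.+ Σℚ (λ i → w₁ i ℚ.* g i)
    Σu g = trans (Σℚ-cong (λ i → ℚP.*-distribʳ-+ (g i) (w₀ i) (w₁ i))) (Σℚ-+ (λ i → w₀ i ℚ.* g i) (λ i → w₁ i ℚ.* g i))
    at-layers : ∀ k → Σℚ (λ i → w₀ i ℚ.* ι (+ t * lookup (layer V h₀ α false i) k)) ℚ.+ Σℚ (λ i → w₁ i ℚ.* ι (+ t * lookup (layer V h₀ α true i) k))
                      ≡ ι (lookup (y ∷ x) k)
    at-layers k = trans (sym (cong₂ ℚ._+_
        (Σℚ-cong (λ i → cong (λ v → w₀ i ℚ.* ι (+ t * lookup v k)) (prism-idx V h₀ α false i)))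
        (Σℚ-cong (λ i → cong (λ v → w₁ i ℚ.* ι (+ t * lookup v k)) (prism-idx V h₀ α true i)))))
      (trans (sym (Σℚ-idx {M} (λ i → w i ℚ.* ι (+ t * lookup (prism V h₀ α i) k)))) (comb k))
    comb-u : Combines u (+ t) V x
    comb-u k = trans (Σu (λ i → ι (+ t * lookup (V i) k))) (at-layers (suc k))
    ιy : Σℚ (λ i → w₁ i ℚ.* ι (+ t * h i)) ≡ ι y
    ιy = trans (sym (ℚP.+-identityˡ _)) (trans (cong (ℚ._+ Σℚ (λ i → w₁ i ℚ.* ι (+ t * h i))) (sym zero-sum)) (at-layers zero))
      where
      zero-sum : Σℚ (λ i → w₀ i ℚ.* ι (+ t * + 0)) ≡ 0ℚ
      zero-sum = trans (Σℚ-cong (λ i → trans (cong (λ z → w₀ i ℚ.* ι z) (ℤP.*-zeroʳ (+ t))) (ℚP.*-zeroʳ (w₀ i)))) (Σℚ-zero M)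
    top≤ : Σℚ (λ i → w₁ i ℚ.* ι (+ t * h i)) ℚ.≤ Σℚ (λ i → u i ℚ.* ι (+ t * h i))
    top≤ = subst₂ ℚ._≤_ (ℚP.+-identityˡ _) (sym (Σu (λ i → ι (+ t * h i))))
      (ℚP.+-monoˡ-≤ (Σℚ (λ i → w₁ i ℚ.* ι (+ t * h i))) (Σℚ-nonneg (λ i → *-nonneg (w≥0 (idx false i)) (0≤th i))))

  -- Each weight of `x` is divided between the bottom and top copies of its vertex in the proportion
  -- `1 - s` to `s`, where `s` is the fraction of the full height at which `y` lies.
  prism-dilate⁺ : ∀ y x → InDilate V t x → + 0 ℤ.≤ y → y ℤ.≤ affine (+ t * h₀) α x →
                  InDilate (prism V h₀ α) t (y ∷ x)
  prism-dilate⁺ y x (w , w≥0 , Σw≡1 , comb) 0≤y y≤H with fraction y (affine (+ t * h₀) α x) 0≤y y≤H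
  ... | s , 0≤s , s≤1 , sH≡y = u , u≥0 , Σu≡1 , comb-u
    where
    r : ℚ
    r = 1ℚ ℚ.- s
    0≤r : 0ℚ ℚ.≤ r
    0≤r = subst (ℚ._≤ r) (ℚP.+-inverseʳ s) (ℚP.+-monoˡ-≤ (ℚ.- s) s≤1)
    r+s : r ℚ.+ s ≡ 1ℚ
    r+s = trans (ℚP.+-assoc 1ℚ (ℚ.- s) s) (trans (cong (1ℚ ℚ.+_) (ℚP.+-inverseˡ s)) (ℚP.+-identityʳ 1ℚ))
    u : Fin (M ℕ.+ M) → ℚ
    u k = [ (λ i → r ℚ.* w i) , (λ i → s ℚ.* w i) ]′ (splitAt M k)
    u₀ : ∀ i → u (idx false i) ≡ r ℚ.* w i
    u₀ i rewrite FP.splitAt-↑ˡ M i M = refl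
    u₁ : ∀ i → u (idx true i) ≡ s ℚ.* w i
    u₁ i rewrite FP.splitAt-↑ʳ M M i = refl
    u≥0 : ∀ k → 0ℚ ℚ.≤ u k
    u≥0 k with splitAt M k
    ... | inj₁ i = *-nonneg 0≤r (w≥0 i)
    ... | inj₂ i = *-nonneg 0≤s (w≥0 i)
    Σu : ∀ (f : Pt (suc n) → ℚ) → Σℚ (λ k → u k ℚ.* f (prism V h₀ α k)) ≡
         r ℚ.* Σℚ (λ i → w i ℚ.* f (layer V h₀ α false i)) ℚ.+ s ℚ.* Σℚ (λ i → w i ℚ.* f (layer V h₀ α true i))
    Σu f = trans (Σℚ-idx {M} (λ k → u k ℚ.* f (prism V h₀ α k))) (cong₂ ℚ._+_
      (trans (Σℚ-cong (λ i → trans (cong₂ (λ a v → a ℚ.* f v) (u₀ i) (prism-idx V h₀ α false i)) (ℚP.*-assoc r (w i) _))) (Σℚ-*ˡ r (λ i → w i ℚ.* f (layer V h₀ α false i))))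
      (trans (Σℚ-cong (λ i → trans (cong₂ (λ a v → a ℚ.* f v) (u₁ i) (prism-idx V h₀ α true i)) (ℚP.*-assoc s (w i) _))) (Σℚ-*ˡ s (λ i → w i ℚ.* f (layer V h₀ α true i)))))
    blend : ∀ q → r ℚ.* q ℚ.+ s ℚ.* q ≡ q
    blend q = trans (sym (ℚP.*-distribʳ-+ q r s)) (trans (cong (ℚ._* q) r+s) (ℚP.*-identityˡ q))
    Σu≡1 : Σℚ u ≡ 1ℚ
    Σu≡1 = trans (Σℚ-idx {M} u) (trans (cong₂ ℚ._+_
      (trans (Σℚ-cong u₀) (trans (Σℚ-*ˡ r w) (cong (r ℚ.*_) Σw≡1)))
      (trans (Σℚ-cong u₁) (trans (Σℚ-*ˡ s w) (cong (s ℚ.*_) Σw≡1)))) (blend 1ℚ))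
    comb-u : Combines u (+ t) (prism V h₀ α) (y ∷ x)
    comb-u (suc k) = trans (Σu (λ v → ι (+ t * lookup v (suc k)))) (trans (blend _) (comb k))
    comb-u zero = trans (Σu (λ v → ι (+ t * lookup v zero))) (trans (cong₂ ℚ._+_
      (trans (cong (r ℚ.*_) zero-sum) (ℚP.*-zeroʳ r))
      (trans (cong (s ℚ.*_) (Combines-affine w (+ t) V x h₀ α Σw≡1 comb)) sH≡y)) (ℚP.+-identityˡ _))
      where
      zero-sum : Σℚ (λ i → w i ℚ.* ι (+ t * + 0)) ≡ 0ℚ
      zero-sum = trans (Σℚ-cong (λ i → trans (cong (λ z → w i ℚ.* ι z) (ℤP.*-zeroʳ (+ t))) (ℚP.*-zeroʳ (w i)))) (Σℚ-zero M)

-- Lattice points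

range : ℤ → List ℤ
range (+ n)    = L.map +_ (downFrom (suc n))
range -[1+ _ ] = []

range⁺ : ∀ {y} H → + 0 ℤ.≤ y → y ℤ.≤ H → y ∈ range H
range⁺ {+ y} (+ n) 0≤y (ℤ.+≤+ y≤n) = ∈-map⁺ +_ (∈-downFrom⁺ (ℕ.s≤s y≤n))

range⁻ : ∀ {y} H → y ∈ range H → + 0 ℤ.≤ y × y ℤ.≤ H
range⁻ (+ n) y∈ with ∈-map⁻ +_ y∈
... | k , k∈ , refl = ℤ.+≤+ ℕ.z≤n , ℤ.+≤+ (ℕP.≤-pred (∈-downFrom⁻ k∈))

range-unique : ∀ H → Unique (range H)
range-unique (+ n)    = Unique.map⁺ ℤP.+-injective (Unique.downFrom⁺ (suc n))
range-unique -[1+ _ ] = []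

-- Weighted sums over lists

sumOver : ∀ {A : Set} → (A → ℤ) → List A → ℤ
sumOver φ []       = + 0
sumOver φ (x ∷ xs) = φ x + sumOver φ xs

sumOver-++ : ∀ {A : Set} (φ : A → ℤ) xs ys → sumOver φ (xs ++ ys) ≡ sumOver φ xs + sumOver φ ys
sumOver-++ φ []       ys = sym (ℤP.+-identityˡ _)
sumOver-++ φ (x ∷ xs) ys = trans (cong (λ z → φ x + z) (sumOver-++ φ xs ys)) (sym (ℤP.+-assoc (φ x) _ _))

sumOver-concatMap : ∀ {A B : Set} (φ : B → ℤ) (f : A → List B) xs →
                    sumOver φ (concatMap f xs) ≡ sumOver (λ x → sumOver φ (f x)) xs
sumOver-concatMap φ f []       = refl
sumOver-concatMap φ f (x ∷ xs) = trans (sumOver-++ φ (f x) (concatMap f xs)) (cong (λ z → sumOver φ (f x) + z) (sumOver-concatMap φ f xs))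

sumOver-map : ∀ {A B : Set} (φ : B → ℤ) (f : A → B) xs → sumOver φ (L.map f xs) ≡ sumOver (φ ∘ f) xs
sumOver-map φ f []       = refl
sumOver-map φ f (x ∷ xs) = cong (λ z → φ (f x) + z) (sumOver-map φ f xs)

sumOver-cong : ∀ {A : Set} {φ ψ : A → ℤ} xs → (∀ {x} → x ∈ xs → φ x ≡ ψ x) → sumOver φ xs ≡ sumOver ψ xs
sumOver-cong []       e = refl
sumOver-cong (x ∷ xs) e = cong₂ _+_ (e (here refl)) (sumOver-cong xs (e ∘ there))

sumOver-*ˡ : ∀ {A : Set} c (φ : A → ℤ) xs → sumOver (λ x → c * φ x) xs ≡ c * sumOver φ xs
sumOver-*ˡ c φ []       = sym (ℤP.*-zeroʳ c)
sumOver-*ˡ c φ (x ∷ xs) = trans (cong (λ z → c * φ x + z) (sumOver-*ˡ c φ xs)) (sym (ℤP.*-distribˡ-+ c (φ x) _))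

length-sumOver : ∀ {A : Set} (xs : List A) → + length xs ≡ sumOver (λ _ → + 1) xs
length-sumOver []       = refl
length-sumOver (x ∷ xs) = cong (λ z → + 1 + z) (length-sumOver xs)

length-range : ∀ {H} → + 0 ℤ.≤ H → + length (range H) ≡ H + + 1
length-range {+ n} _ = cong +_ (trans (cong suc (trans (L.length-map +_ (downFrom n)) (L.length-downFrom n))) (ℕP.+-comm 1 n))

-- The lattice points of all dilates, `t = 0` included, are carried as data, so that a prism builds
-- its lists from those of its base. The vertex `base` records nonemptiness for `prism-fullDim`.
record SmoothPolytope (n : ℕ) : Set where
  field
    size     : ℕ
    V        : Fin size → Pt n
    base     : Fin size
    vertex   : ∀ i → IsVertex V i
    fullDim  : FullDim V
    smooth   : Smooth V
    points   : ℕ → List (Pt n)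
    unique   : ∀ t → Unique (points t)
    complete : ∀ t x → (x ∈ points t) ⇔ InDilate V t x

open SmoothPolytope

origin : SmoothPolytope 0
origin .size = 1
origin .V _ = []
origin .base = zero
origin .vertex zero = [] , λ { zero 0≢0 → contradiction refl 0≢0 }
origin .fullDim [] _ = refl
origin .smooth zero = (λ ()) , (λ { {()} }) , (λ ()) , (λ { zero (0≢0 , _) → contradiction refl 0≢0 })
                    , (λ ()) , (λ ()) , (λ { [] → (λ ()) , refl }) , λ c _ → λ ()
origin .points _ = [] ∷ []
origin .unique _ = [] ∷ []
origin .complete t [] = mk⇔ (λ _ → (λ _ → 1ℚ) , (λ _ → ι-mono-≤ {+ 0} {+ 1} (ℤ.+≤+ ℕ.z≤n)) , refl , λ ()) (λ _ → here refl)

module _ {n} (P : SmoothPolytope n) (h₀ : ℤ) (α : Pt n) (h>0 : ∀ j → + 0 ℤ.< affine h₀ α (P .V j)) where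

  private
    height : ℕ → Pt n → ℤ
    height t = affine (+ t * h₀) α

    fibre : ℕ → Pt n → List (Pt (suc n))
    fibre t x = L.map (_∷ x) (range (height t x))

    fibres : ℕ → List (Pt (suc n))
    fibres t = concatMap (fibre t) (P .points t)

    fibres-unique : ∀ t → Unique (fibres t)
    fibres-unique t = Unique.concat⁺
      (All.map⁺ (All.tabulate (λ {x} _ → Unique.map⁺ VP.∷-injectiveˡ (range-unique (height t x)))))
      (AllPairs.map⁺ (AllPairs.map disjoint (P .unique t)))
      where
      disjoint : ∀ {x x′} → x ≢ x′ → ∀ {v} → ¬ (v ∈ fibre t x × v ∈ fibre t x′)
      disjoint {x} {x′} x≢x′ (v∈ , v∈′) with ∈-map⁻ (_∷ x) v∈ | ∈-map⁻ (_∷ x′) v∈′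
      ... | _ , _ , refl | _ , _ , e = x≢x′ (VP.∷-injectiveʳ e)

    fibres-complete : ∀ t v → (v ∈ fibres t) ⇔ InDilate (prism (P .V) h₀ α) t v
    fibres-complete t (y ∷ x) = mk⇔ to from
      where
      to : (y ∷ x) ∈ fibres t → InDilate (prism (P .V) h₀ α) t (y ∷ x)
      to v∈ with find (∈-concatMap⁻ (fibre t) {xs = P .points t} v∈)
      ... | x′ , x′∈ , v∈′ with ∈-map⁻ (_∷ x′) v∈′
      ... | _ , y∈ , refl with range⁻ (height t x) y∈
      ... | 0≤y , y≤H = prism-dilate⁺ (P .V) h₀ α h>0 t y x (Equivalence.to (P .complete t x) x′∈) 0≤y y≤H
      from : InDilate (prism (P .V) h₀ α) t (y ∷ x) → (y ∷ x) ∈ fibres t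
      from d with prism-dilate⁻ (P .V) h₀ α h>0 t y x d
      ... | dx , 0≤y , y≤H = ∈-concatMap⁺ (fibre t)
        (lose (Equivalence.from (P .complete t x) dx) (∈-map⁺ (_∷ x) (range⁺ (height t x) 0≤y y≤H)))

  prismOver : SmoothPolytope (suc n)
  prismOver .size     = P .size ℕ.+ P .size
  prismOver .V        = prism (P .V) h₀ α
  prismOver .base     = idx false (P .base)
  prismOver .vertex   = prism-vertex (P .V) h₀ α h>0 (P .vertex)
  prismOver .fullDim  = prism-fullDim (P .V) h₀ α h>0 (P .base) (P .fullDim)
  prismOver .smooth   = prism-smooth (P .V) h₀ α h>0 (P .vertex) (P .smooth)
  prismOver .points   = fibres
  prismOver .unique   = fibres-unique
  prismOver .complete = fibres-complete

  -- The fibre over `x` has one lattice point more than its height. The weight `φ` allows the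
  -- formula to be iterated when the base is itself a prism.
  sumOver-prism : ∀ t (φ : Pt n → ℤ) → sumOver (φ ∘ tail) (prismOver .points t) ≡
                  sumOver (λ x → (affine (+ t * h₀) α x + + 1) * φ x) (P .points t)
  sumOver-prism t φ = trans (sumOver-concatMap (φ ∘ tail) (fibre t) (P .points t)) (sumOver-cong (P .points t) eq)
    where
    eq : ∀ {x} → x ∈ P .points t → sumOver (φ ∘ tail) (fibre t x) ≡ (height t x + + 1) * φ x
    eq {x} x∈ = begin
      sumOver (φ ∘ tail) (fibre t x)                    ≡⟨ sumOver-map (φ ∘ tail) (_∷ x) (range (height t x)) ⟩
      sumOver (λ _ → φ x) (range (height t x))          ≡⟨ sumOver-cong (range (height t x)) (λ _ → sym (ℤP.*-identityʳ (φ x))) ⟩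
      sumOver (λ _ → φ x * + 1) (range (height t x))    ≡⟨ sumOver-*ˡ (φ x) (λ _ → + 1) (range (height t x)) ⟩
      φ x * sumOver (λ _ → + 1) (range (height t x))    ≡⟨ cong (φ x *_) (sym (length-sumOver (range (height t x)))) ⟩
      φ x * + length (range (height t x))               ≡⟨ cong (φ x *_) (length-range (height-nonneg (P .V) h₀ α h>0 t x (Equivalence.to (P .complete t x) x∈))) ⟩
      φ x * (height t x + + 1)                          ≡⟨ ℤP.*-comm (φ x) _ ⟩
      (height t x + + 1) * φ x                          ∎
      where open ≡-Reasoning

-- Ehrhart polynomials

open SmoothPolytope

evalPoly : (ℕ → ℤ) → ℕ → ℤ → ℤ
evalPoly c N x = Σℤ {N} (λ j → c (toℕ j) * x ^ toℕ j)

Σℤ-snoc : ∀ N (g : ℕ → ℤ) → Σℤ {suc N} (g ∘ toℕ) ≡ Σℤ {N} (g ∘ toℕ) + g N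
Σℤ-snoc zero    g = ℤP.+-comm (g 0) (+ 0)
Σℤ-snoc (suc N) g = trans (cong (λ z → g 0 + z) (Σℤ-snoc N (g ∘ suc))) (sym (ℤP.+-assoc (g 0) _ _))

ι-evalPoly : ∀ c N x → ι (evalPoly c N x) ≡ Σℚ {N} (λ j → ι (c (toℕ j)) ℚ.* powℚ (ι x) (toℕ j))
ι-evalPoly c N x = trans (ι-Σ {N} (λ j → c (toℕ j) * x ^ toℕ j))
  (Σℚ-cong {N} (λ j → trans (ι-* (c (toℕ j)) (x ^ toℕ j)) (cong (ι (c (toℕ j)) ℚ.*_) (ι-^ x (toℕ j)))))

mulLinear : ℤ → (ℕ → ℤ) → ℕ → ℤ
mulLinear m c zero    = c zero
mulLinear m c (suc j) = c (suc j) + m * c j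

-- The first `suc N` coefficients of the product involve `c N`, which the sum of `N` terms omits.
-- The correction vanishes when `c` has degree below `N`.
evalPoly-mulLinear : ∀ m c N x → evalPoly (mulLinear m c) (suc N) x ≡ (m * x + + 1) * evalPoly c N x + c N * x ^ N
evalPoly-mulLinear m c zero    x = lem (m * x + + 1) (c 0)
  where
  lem : ∀ a b → b * + 1 + + 0 ≡ a * + 0 + b * + 1
  lem = solve-∀
evalPoly-mulLinear m c (suc N) x = begin
  evalPoly (mulLinear m c) (suc (suc N)) x
    ≡⟨ Σℤ-snoc (suc N) (λ j → mulLinear m c j * x ^ j) ⟩
  evalPoly (mulLinear m c) (suc N) x + (c (suc N) + m * c N) * (x * x ^ N)
    ≡⟨ cong (_+ (c (suc N) + m * c N) * (x * x ^ N)) (evalPoly-mulLinear m c N x) ⟩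
  ((m * x + + 1) * evalPoly c N x + c N * x ^ N) + (c (suc N) + m * c N) * (x * x ^ N)
    ≡⟨ lem m x (evalPoly c N x) (c N) (c (suc N)) (x ^ N) ⟩
  (m * x + + 1) * (evalPoly c N x + c N * x ^ N) + c (suc N) * (x * x ^ N)
    ≡⟨ cong (λ z → (m * x + + 1) * z + c (suc N) * (x * x ^ N)) (sym (Σℤ-snoc N (λ j → c j * x ^ j))) ⟩
  (m * x + + 1) * evalPoly c (suc N) x + c (suc N) * (x * x ^ N) ∎
  where
  open ≡-Reasoning
  lem : ∀ m x e a b y → ((m * x + + 1) * e + a * y) + (b + m * a) * (x * y) ≡ (m * x + + 1) * (e + a * y) + b * (x * y)
  lem = solve-∀

0≤+ : ∀ {x y} → + 0 ℤ.≤ x → + 0 ℤ.≤ y → + 0 ℤ.≤ x + y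
0≤+ = ℤP.+-mono-≤

0≤* : ∀ {x y} → + 0 ℤ.≤ x → + 0 ℤ.≤ y → + 0 ℤ.≤ x * y
0≤* {x} {y} 0≤x 0≤y = subst (ℤ._≤ x * y) (ℤP.*-zeroʳ x) (ℤP.*-monoˡ-≤-nonNeg x {{ℤ.nonNegative 0≤x}} 0≤y)

0≤ℕ : ∀ {k} → + 0 ℤ.≤ + k
0≤ℕ = ℤ.+≤+ ℕ.z≤n

-- Reduces an inequality to a ring identity that rewrites the difference as a visibly nonnegative
-- expression `z`.
≤-via : ∀ {x y} z → + 0 ℤ.≤ z → y - x ≡ z → x ℤ.≤ y
≤-via z 0≤z e = ℤP.0≤i-j⇒j≤i (subst (+ 0 ℤ.≤_) (sym e) 0≤z)

-- The cube Q and its lattice points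

module _ (r : ℕ) where

  segment : SmoothPolytope 1
  segment = prismOver origin (+ 1) [] (λ _ → ℤ.+<+ (ℕ.s≤s ℕ.z≤n))

  private
    pos : ∀ {x} k → x ≡ + suc k → + 0 ℤ.< x
    pos k refl = ℤ.+<+ (ℕ.s≤s ℕ.z≤n)

    lem₀ : ∀ r → + 1 + r + (- r * + 0 + + 0) ≡ + 1 + r
    lem₀ = solve-∀
    lem₁ : ∀ r → + 1 + r + (- r * + 1 + + 0) ≡ + 1
    lem₁ = solve-∀
    lem₂ : ∀ r x → + 1 + (+ 0 * x + (r * + 0 + + 0)) ≡ + 1
    lem₂ = solve-∀
    lem₃ : ∀ r x → + 1 + (+ 0 * x + (r * + 1 + + 0)) ≡ + 1 + r
    lem₃ = solve-∀

  trapezoid-pos : ∀ j → + 0 ℤ.< affine (+ suc r) (- + r ∷ []) (segment .V j)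
  trapezoid-pos zero       = pos r (lem₀ (+ r))
  trapezoid-pos (suc zero) = pos 0 (lem₁ (+ r))

  trapezoid : SmoothPolytope 2
  trapezoid = prismOver segment (+ suc r) (- + r ∷ []) trapezoid-pos

  twisted-pos : ∀ j → + 0 ℤ.< affine (+ 1) (+ 0 ∷ + r ∷ []) (trapezoid .V j)
  twisted-pos zero                   = pos 0 (lem₂ (+ r) (+ 0))
  twisted-pos (suc zero)             = pos r (lem₃ (+ r) (+ 0))
  twisted-pos (suc (suc zero))       = pos 0 (lem₂ (+ r) (affine (+ suc r) (- + r ∷ []) (segment .V zero)))
  twisted-pos (suc (suc (suc zero))) = pos r (lem₃ (+ r) (affine (+ suc r) (- + r ∷ []) (segment .V (suc zero))))

  -- The cube Q: the points (y , x , z) with 0 ≤ z ≤ 1, 0 ≤ x ≤ 1 + r (1 - z) and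
  -- 0 ≤ y ≤ 1 + r z.
  twisted : SmoothPolytope 3
  twisted = prismOver trapezoid (+ 1) (+ 0 ∷ + r ∷ []) twisted-pos

  segment-points : ∀ t → segment .points t ≡ L.map (_∷ []) (L.map +_ (downFrom (suc t)))
  segment-points t = trans (cong (λ H → L.map (_∷ []) (range H) ++ []) (trans (ℤP.+-identityʳ _) (ℤP.*-identityʳ (+ t)))) (L.++-identityʳ _)

  private
    -- The number of lattice points of tQ at the level `z`: the slice is a rectangle, whence the
    -- product of two side counts.
    ψ : ℕ → Pt 1 → ℤ
    ψ t v = (affine (+ t * + suc r) (- + r ∷ []) v + + 1) * (affine (+ t * + 1) (+ r ∷ []) v + + 1)

    -- The last level `s` is kept apart from the dilation `t`, so that induction on `s` can run with
    -- `t` fixed; the count is `S t t`.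
    S : ℕ → ℕ → ℤ
    S t s = sumOver (ψ t) (L.map (_∷ []) (L.map +_ (downFrom (suc s))))

    -- With A = t(1 + r) + 1 and B = t + 1, a level contributes (A - rz)(B + rz) = AB + r²tz - r²z²,
    -- as A - B = rt. The factor 6 clears the denominators of the sums of z and z².
    closed : ℤ → ℤ → ℤ → ℤ
    closed r t s = + 6 * (t * (+ 1 + r) + + 1) * (t + + 1) * (s + + 1) + + 3 * r * r * t * s * (s + + 1)
                   - r * r * s * (s + + 1) * (+ 2 * s + + 1)

    S-closed : ∀ t s → + 6 * S t s ≡ closed (+ r) (+ t) (+ s)
    S-closed t zero    = lem (+ r) (+ t)
      where
      lem : ∀ r t → + 6 * ((t * (+ 1 + r) + (- r * + 0 + + 0) + + 1) * (t * + 1 + (r * + 0 + + 0) + + 1) + + 0) ≡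
                    + 6 * (t * (+ 1 + r) + + 1) * (t + + 1) * (+ 0 + + 1) + + 3 * r * r * t * + 0 * (+ 0 + + 1)
                    - r * r * + 0 * (+ 0 + + 1) * (+ 2 * + 0 + + 1)
      lem = solve-∀
    S-closed t (suc s) = trans (ℤP.*-distribˡ-+ (+ 6) (ψ t (+ suc s ∷ [])) (S t s))
      (trans (cong (λ z → + 6 * ψ t (+ suc s ∷ []) + z) (S-closed t s)) (lem (+ r) (+ t) (+ s)))
      where
      lem : ∀ r t s → + 6 * ((t * (+ 1 + r) + (- r * (+ 1 + s) + + 0) + + 1) * (t * + 1 + (r * (+ 1 + s) + + 0) + + 1))
                      + (+ 6 * (t * (+ 1 + r) + + 1) * (t + + 1) * (s + + 1) + + 3 * r * r * t * s * (s + + 1)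
                         - r * r * s * (s + + 1) * (+ 2 * s + + 1)) ≡
                    + 6 * (t * (+ 1 + r) + + 1) * (t + + 1) * ((+ 1 + s) + + 1) + + 3 * r * r * t * (+ 1 + s) * ((+ 1 + s) + + 1)
                    - r * r * (+ 1 + s) * ((+ 1 + s) + + 1) * (+ 2 * (+ 1 + s) + + 1)
      lem = solve-∀

  twisted-count : ∀ t → + 6 * + length (twisted .points t) ≡ closed (+ r) (+ t) (+ t)
  twisted-count t = trans (cong (+ 6 *_) (begin
    + length (twisted .points t)
      ≡⟨ length-sumOver (twisted .points t) ⟩
    sumOver (λ _ → + 1) (twisted .points t)
      ≡⟨ sumOver-prism trapezoid (+ 1) (+ 0 ∷ + r ∷ []) twisted-pos t (λ _ → + 1) ⟩
    sumOver (λ x → (affine (+ t * + 1) (+ 0 ∷ + r ∷ []) x + + 1) * + 1) (trapezoid .points t)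
      -- The height of the last prism depends on z but not on x, so the summand factors through
      -- `tail` and the prism formula applies a second time.
      ≡⟨ sumOver-cong (trapezoid .points t) (λ {x} _ → drop x) ⟩
    sumOver ((λ v → affine (+ t * + 1) (+ r ∷ []) v + + 1) ∘ tail) (trapezoid .points t)
      ≡⟨ sumOver-prism segment (+ suc r) (- + r ∷ []) trapezoid-pos t _ ⟩
    sumOver (ψ t) (segment .points t)
      ≡⟨ cong (sumOver (ψ t)) (segment-points t) ⟩
    S t t ∎)) (S-closed t t)
    where
    open ≡-Reasoning
    drop : ∀ x → (affine (+ t * + 1) (+ 0 ∷ + r ∷ []) x + + 1) * + 1 ≡ affine (+ t * + 1) (+ r ∷ []) (tail x) + + 1
    drop (x ∷ z) = lem (+ t * + 1) x (dot (+ r ∷ []) z)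
      where
      lem : ∀ t x d → (t + (+ 0 * x + d) + + 1) * + 1 ≡ t + d + + 1
      lem = solve-∀

-- Induction on the dimension

record NegativeEhrhart (d C K : ℕ) : Set where
  field
    -- The top coefficients, in degrees 3 + d, 2 + d and 1 + d, are called u, v and w. `K` makes
    -- both -c₁ and the ratio of -w to v as large as desired, while `C` bounds the ratio of u to -w.
    P       : SmoothPolytope (3 ℕ.+ d)
    c       : ℕ → ℤ
    ehrhart : ∀ t → + length (P .points t) ≡ evalPoly c (4 ℕ.+ d) (+ t)
    vanish  : ∀ j → 4 ℕ.+ d ℕ.≤ j → c j ≡ + 0
    c₀      : c 0 ≡ + 1
    c₁      : c 1 ℤ.≤ - (+ 1 + + K)
    neg     : ∀ j → 1 ℕ.≤ j → j ℕ.≤ 1 ℕ.+ d → c j ℤ.< + 0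
    0≤v     : + 0 ℤ.≤ c (2 ℕ.+ d)
    0≤u     : + 0 ℤ.≤ c (3 ℕ.+ d)
    Kv≤w    : + K * c (2 ℕ.+ d) ℤ.≤ - c (1 ℕ.+ d)
    u≤Cw    : c (3 ℕ.+ d) ℤ.≤ + C * - c (1 ℕ.+ d)

open NegativeEhrhart

-- The Ehrhart coefficients of Q for r = 12 k + 18, where they are integers.
twistedCoeff : ℤ → ℕ → ℤ
twistedCoeff k 0 = + 1
twistedCoeff k 1 = - (+ 24 * (k * k) + + 60 * k + + 33)
twistedCoeff k 2 = + 24 * k + + 39
twistedCoeff k 3 = + 24 * (k * k) + + 84 * k + + 73
twistedCoeff k _ = + 0

-- The nonconstant coefficients of Q are 3 + r - r²/6, 3 + 2r and 1 + r + r²/6. The r² terms cancel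
-- in the middle one, so the ratio of -w to v grows with r, while that of u to -w stays bounded,
-- here by 3. As 12 `K` + 18 is a multiple of 6, all are integers.
negative₃ : ∀ K → NegativeEhrhart 0 3 K
negative₃ K .P = twisted (12 ℕ.* K ℕ.+ 18)
negative₃ K .c = twistedCoeff (+ K)
negative₃ K .ehrhart t = ℤP.*-cancelˡ-≡ (+ 6) _ _ (trans (twisted-count (12 ℕ.* K ℕ.+ 18) t)
  (trans (cong (λ r → closed′ r (+ t)) r≡) (lem (+ K) (+ t))))
  where
  closed′ : ℤ → ℤ → ℤ
  closed′ r t = + 6 * (t * (+ 1 + r) + + 1) * (t + + 1) * (t + + 1) + + 3 * r * r * t * t * (t + + 1)
                - r * r * t * (t + + 1) * (+ 2 * t + + 1)
  r≡ : + (12 ℕ.* K ℕ.+ 18) ≡ + 12 * + K + + 18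
  r≡ = cong (_+ + 18) (ℤP.pos-* 12 K)
  lem : ∀ k t → + 6 * (t * (+ 1 + (+ 12 * k + + 18)) + + 1) * (t + + 1) * (t + + 1) + + 3 * (+ 12 * k + + 18) * (+ 12 * k + + 18) * t * t * (t + + 1)
                - (+ 12 * k + + 18) * (+ 12 * k + + 18) * t * (t + + 1) * (+ 2 * t + + 1) ≡
        + 6 * (+ 1 * + 1 + (- (+ 24 * (k * k) + + 60 * k + + 33) * (t * + 1) + ((+ 24 * k + + 39) * (t * (t * + 1))
             + ((+ 24 * (k * k) + + 84 * k + + 73) * (t * (t * (t * + 1))) + + 0))))
  lem = solve-∀
negative₃ K .vanish _ (ℕ.s≤s (ℕ.s≤s (ℕ.s≤s (ℕ.s≤s _)))) = refl
negative₃ K .c₀ = refl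
negative₃ K .c₁ = ℤP.neg-mono-≤ (≤-via (+ 24 * (+ K * + K) + + 59 * + K + + 32)
  (0≤+ (0≤+ (0≤* {+ 24} 0≤ℕ (0≤* {+ K} 0≤ℕ 0≤ℕ)) (0≤* {+ 59} {+ K} 0≤ℕ 0≤ℕ)) 0≤ℕ) (lem (+ K)))
  where
  lem : ∀ k → + 24 * (k * k) + + 60 * k + + 33 - (+ 1 + k) ≡ + 24 * (k * k) + + 59 * k + + 32
  lem = solve-∀
negative₃ K .neg 1 _ _ = ℤP.≤-<-trans (negative₃ K .c₁) (ℤ.-<+)
negative₃ K .neg (suc (suc _)) _ (ℕ.s≤s ())
negative₃ K .0≤v = 0≤+ (0≤* {+ 24} {+ K} 0≤ℕ 0≤ℕ) 0≤ℕ
negative₃ K .0≤u = 0≤+ (0≤+ (0≤* {+ 24} 0≤ℕ (0≤* {+ K} 0≤ℕ 0≤ℕ)) (0≤* {+ 84} {+ K} 0≤ℕ 0≤ℕ)) 0≤ℕ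
negative₃ K .Kv≤w = ≤-via (+ 21 * + K + + 33) (0≤+ (0≤* {+ 21} {+ K} 0≤ℕ 0≤ℕ) 0≤ℕ) (lem (+ K))
  where
  lem : ∀ k → - - (+ 24 * (k * k) + + 60 * k + + 33) - k * (+ 24 * k + + 39) ≡ + 21 * k + + 33
  lem = solve-∀
negative₃ K .u≤Cw = ≤-via (+ 48 * (+ K * + K) + + 96 * + K + + 26)
  (0≤+ (0≤+ (0≤* {+ 48} 0≤ℕ (0≤* {+ K} 0≤ℕ 0≤ℕ)) (0≤* {+ 96} {+ K} 0≤ℕ 0≤ℕ)) 0≤ℕ) (lem (+ K))
  where
  lem : ∀ k → + 3 * - - (+ 24 * (k * k) + + 60 * k + + 33) - (+ 24 * (k * k) + + 84 * k + + 73) ≡ + 48 * (k * k) + + 96 * k + + 26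
  lem = solve-∀

-- Write m for this value and W for -w. The part k(C + 1) pays for k(u + mv), since ku ≤ kCW and mv
-- ≤ W. The summand 2 leaves room for v ≤ W twice: mW - 2v ≥ 0 is what bounds the new u with
-- constant 2C.
factor : ℤ → ℤ → ℤ
factor k C = + 2 + k * (C + + 1)

-- Multiplication by 1 + m t turns the top coefficients w, v, u into v + m w, u + m v, m u.
-- For m = factor k C the bounds on these are nonnegative combinations of W = - w,
-- p = C W - u and q = W - (k + m) v.
module _ {k C v u w : ℤ} (0≤k : + 0 ℤ.≤ k) (0≤C : + 0 ℤ.≤ C) (0≤v : + 0 ℤ.≤ v) (w<0 : w ℤ.< + 0)
         (v≤w : (k + factor k C) * v ℤ.≤ - w) (u≤w : u ℤ.≤ C * - w) where

  private
    m W p q : ℤ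
    m = factor k C
    W = - w
    p = C * - w - u
    q = - w - (k + m) * v

    0≤p : + 0 ℤ.≤ p
    0≤p = ℤP.i≤j⇒0≤j-i u≤w

    0≤q : + 0 ℤ.≤ q
    0≤q = ℤP.i≤j⇒0≤j-i v≤w

    0≤W : + 0 ℤ.≤ W
    0≤W = ℤP.<⇒≤ (ℤP.neg-mono-< w<0)

    0≤kC+1 : + 0 ℤ.≤ k * (C + + 1)
    0≤kC+1 = 0≤* 0≤k (0≤+ 0≤C 0≤ℕ)

    0≤m : + 0 ℤ.≤ m
    0≤m = 0≤+ {+ 2} 0≤ℕ 0≤kC+1

    W-v : ℤ
    -- This is W - v; the coefficient of `v` is k + m - 1, written as a sum of nonnegative terms.
    W-v = q + (+ 1 + k + k * (C + + 1)) * v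

    0≤W-v : + 0 ℤ.≤ W-v
    0≤W-v = 0≤+ 0≤q (0≤* (0≤+ (0≤+ {+ 1} 0≤ℕ 0≤k) 0≤kC+1) 0≤v)

  step-neg : v + m * w ℤ.< + 0
  step-neg = subst (ℤ._< + 0) (sym (lem k C v w)) (ℤP.+-mono-<-≤ w<0 (ℤP.neg-mono-≤ (0≤+ (0≤* 0≤kC+1 0≤W) 0≤W-v)))
    where
    lem : ∀ k C v w → v + (+ 2 + k * (C + + 1)) * w ≡
          w + - (k * (C + + 1) * - w + ((- w - (k + (+ 2 + k * (C + + 1))) * v) + (+ 1 + k + k * (C + + 1)) * v))
    lem = solve-∀

  step-v : k * (u + m * v) ℤ.≤ - (v + m * w)
  step-v = ≤-via (k * p + k * (q + k * v) + (W + W-v))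
      (0≤+ (0≤+ (0≤* 0≤k 0≤p) (0≤* 0≤k (0≤+ 0≤q (0≤* 0≤k 0≤v)))) (0≤+ 0≤W 0≤W-v)) (lem k C v u w)
    where
    lem : ∀ k C v u w → - (v + (+ 2 + k * (C + + 1)) * w) - k * (u + (+ 2 + k * (C + + 1)) * v) ≡
          k * (C * - w - u) + k * ((- w - (k + (+ 2 + k * (C + + 1))) * v) + k * v)
          + (- w + ((- w - (k + (+ 2 + k * (C + + 1))) * v) + (+ 1 + k + k * (C + + 1)) * v))
    lem = solve-∀

  step-u : m * u ℤ.≤ (+ 2 * C) * - (v + m * w)
  step-u = ≤-via (m * p + C * (k * (C + + 1) * W + + 2 * W-v))
      (0≤+ (0≤* 0≤m 0≤p) (0≤* 0≤C (0≤+ (0≤* 0≤kC+1 0≤W) (0≤* {+ 2} 0≤ℕ 0≤W-v)))) (lem k C v u w)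
    where
    lem : ∀ k C v u w → (+ 2 * C) * - (v + (+ 2 + k * (C + + 1)) * w) - (+ 2 + k * (C + + 1)) * u ≡
          (+ 2 + k * (C + + 1)) * (C * - w - u)
          + C * (k * (C + + 1) * - w + + 2 * ((- w - (k + (+ 2 + k * (C + + 1))) * v) + (+ 1 + k + k * (C + + 1)) * v))
    lem = solve-∀

module _ {n} (P : SmoothPolytope n) (m : ℕ) where

  private
    m>0 : ∀ j → + 0 ℤ.< affine (+ suc m) 0ᵥ (P .V j)
    m>0 j = subst (+ 0 ℤ.<_) (sym (trans (cong (λ z → + suc m + z) (dot-zeroˡ (P .V j))) (ℤP.+-identityʳ _))) (ℤ.+<+ (ℕ.s≤s ℕ.z≤n))

  -- A prism of constant height is the product with a segment; the successor keeps the height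
  -- positive.
  timesSegment : SmoothPolytope (suc n)
  timesSegment = prismOver P (+ suc m) 0ᵥ m>0

  timesSegment-count : ∀ t → + length (timesSegment .points t) ≡ (+ suc m * + t + + 1) * + length (P .points t)
  timesSegment-count t = begin
    + length (timesSegment .points t)
      ≡⟨ length-sumOver (timesSegment .points t) ⟩
    sumOver (λ _ → + 1) (timesSegment .points t)
      ≡⟨ sumOver-prism P (+ suc m) 0ᵥ m>0 t (λ _ → + 1) ⟩
    sumOver (λ x → (affine (+ t * + suc m) 0ᵥ x + + 1) * + 1) (P .points t)
      ≡⟨ sumOver-cong (P .points t) (λ {x} _ → cong (λ z → (z + + 1) * + 1) (height≡ x)) ⟩
    sumOver (λ _ → (+ suc m * + t + + 1) * + 1) (P .points t)
      ≡⟨ sumOver-*ˡ (+ suc m * + t + + 1) (λ _ → + 1) (P .points t) ⟩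
    (+ suc m * + t + + 1) * sumOver (λ _ → + 1) (P .points t)
      ≡⟨ cong (λ z → (+ suc m * + t + + 1) * z) (sym (length-sumOver (P .points t))) ⟩
    (+ suc m * + t + + 1) * + length (P .points t) ∎
    where
    open ≡-Reasoning
    height≡ : ∀ x → affine (+ t * + suc m) 0ᵥ x ≡ + suc m * + t
    height≡ x = trans (cong (λ z → + t * + suc m + z) (dot-zeroˡ x)) (trans (ℤP.+-identityʳ _) (ℤP.*-comm (+ t) (+ suc m)))

-- For the desired `K` the length `m` is fixed first, from `K` and `C`. Only then is the lower
-- polytope taken, with parameter `K + m`, so that its negative coefficients outweigh what `m` adds.
negative-step : ∀ {d C} → (∀ K → NegativeEhrhart d C K) → ∀ K → NegativeEhrhart (suc d) (2 ℕ.* C) K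
negative-step {d} {C} G K = record
  -- `timesSegment` adds 1 to its argument, so the segment has length `m`.
  { P       = timesSegment (g .P) (suc (K ℕ.* (C ℕ.+ 1)))
  ; c       = c′
  ; ehrhart = λ t → trans (timesSegment-count (g .P) _ t) (trans (cong (λ z → (+ m * + t + + 1) * z) (g .ehrhart t))
                (sym (trans (evalPoly-mulLinear (+ m) (g .c) (4 ℕ.+ d) (+ t))
                  (trans (cong (λ z → (+ m * + t + + 1) * evalPoly (g .c) (4 ℕ.+ d) (+ t) + z * (+ t) ^ (4 ℕ.+ d)) (g .vanish (4 ℕ.+ d) ℕP.≤-refl))
                    (ℤP.+-identityʳ _)))))
  ; vanish  = vanish′
  ; c₀      = g .c₀
  ; c₁      = c₁′
  ; neg     = neg′
  ; 0≤v     = 0≤+ (g .0≤u) (0≤* {+ m} 0≤ℕ (g .0≤v))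
  ; 0≤u     = subst (+ 0 ℤ.≤_) (sym top) (0≤* {+ m} 0≤ℕ (g .0≤u))
  ; Kv≤w    = subst (λ z → + K * (u + z * v) ℤ.≤ - (v + z * w)) (sym m≡) (step-v {+ K} {+ C} {v} {u} {w} 0≤ℕ 0≤ℕ (g .0≤v) w<0 v≤w (g .u≤Cw))
  ; u≤Cw    = subst₂ ℤ._≤_ (trans (cong (_* u) (sym m≡)) (sym top))
                (cong₂ (λ a z → a * - (v + z * w)) (sym (ℤP.pos-* 2 C)) (sym m≡))
                (step-u {+ K} {+ C} {v} {u} {w} 0≤ℕ 0≤ℕ (g .0≤v) w<0 v≤w (g .u≤Cw))
  }
  where
  m : ℕ
  m = 2 ℕ.+ K ℕ.* (C ℕ.+ 1)
  g : NegativeEhrhart d C (K ℕ.+ m)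
  g = G (K ℕ.+ m)
  c′ : ℕ → ℤ
  c′ = mulLinear (+ m) (g .c)
  w v u : ℤ
  w = g .c (1 ℕ.+ d)
  v = g .c (2 ℕ.+ d)
  u = g .c (3 ℕ.+ d)
  m≡ : + m ≡ + 2 + + K * (+ C + + 1)
  m≡ = cong (λ z → + 2 + z) (ℤP.pos-* K (C ℕ.+ 1))
  w<0 : w ℤ.< + 0
  w<0 = g .neg (1 ℕ.+ d) (ℕ.s≤s ℕ.z≤n) ℕP.≤-refl
  v≤w : (+ K + (+ 2 + + K * (+ C + + 1))) * v ℤ.≤ - w
  v≤w = subst (λ z → (+ K + z) * v ℤ.≤ - w) m≡ (g .Kv≤w)
  top : c′ (4 ℕ.+ d) ≡ + m * u
  top = trans (cong (_+ + m * u) (g .vanish (4 ℕ.+ d) ℕP.≤-refl)) (ℤP.+-identityˡ _)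
  lem : ∀ k m → - (+ 1 + (k + m)) + m ≡ - (+ 1 + k)
  lem = solve-∀
  -- The constant coefficient 1 adds exactly `m` to the linear one, which the parameter `K + m` has
  -- allowed for.
  c₁′ : c′ 1 ℤ.≤ - (+ 1 + + K)
  c₁′ = subst (c′ 1 ℤ.≤_) (lem (+ K) (+ m))
    (ℤP.+-mono-≤ (g .c₁) (ℤP.≤-reflexive (trans (cong (+ m *_) (g .c₀)) (ℤP.*-identityʳ (+ m)))))
  vanish′ : ∀ j → 5 ℕ.+ d ℕ.≤ j → c′ j ≡ + 0
  vanish′ (suc j) (ℕ.s≤s le) = trans (cong₂ (λ a b → a + + m * b) (g .vanish (suc j) (ℕP.m≤n⇒m≤1+n le)) (g .vanish j le))
                                     (trans (ℤP.+-identityˡ _) (ℤP.*-zeroʳ (+ m)))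
  neg′ : ∀ j → 1 ℕ.≤ j → j ℕ.≤ 2 ℕ.+ d → c′ j ℤ.< + 0
  neg′ 1 _ _ = ℤP.≤-<-trans c₁′ ℤ.-<+
  -- Only the new coefficient in degree 2 + d mixes signs, as v + mw, and needs `step-neg`. Those
  -- below it are sums of two negative terms.
  neg′ (suc (suc j)) _ le with ℕP.m≤n⇒m<n∨m≡n le
  ... | inj₂ refl = subst (λ z → v + z * w ℤ.< + 0) (sym m≡) (step-neg {+ K} {+ C} {v} {u} {w} 0≤ℕ 0≤ℕ (g .0≤v) w<0 v≤w (g .u≤Cw))
  ... | inj₁ lt   = ℤP.+-mono-< (g .neg (2 ℕ.+ j) (ℕ.s≤s ℕ.z≤n) (ℕP.≤-pred lt))
      (subst (+ m * g .c (suc j) ℤ.<_) (ℤP.*-zeroʳ (+ m))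
        (ℤP.*-monoˡ-<-pos (+ m) (g .neg (suc j) (ℕ.s≤s ℕ.z≤n) (ℕP.≤-trans (ℕP.n≤1+n _) (ℕP.≤-pred lt)))))

-- `C` depends on `d` alone, namely 3 times the `d`-th power of 2. It precedes `K` because the step
-- chooses its segment length from `C` before it fixes the parameter of the lower polytope.
negative : ∀ d → ∃ λ C → ∀ K → NegativeEhrhart d C K
negative zero    = 3 , negative₃
negative (suc d) with negative d
... | C , G = 2 ℕ.* C , negative-step G

theorem1p2 : ∀ (n : ℕ) → 3 ≤ n →
    ∃ λ (m : ℕ) → Σ (Fin m → Pt n) λ V →
    (∀ i → IsVertex V i) × FullDim V × Smooth V
    × (∃ λ c → IsEhrhartPoly V c
    × (∀ (j : Fin (suc n)) → 1 ≤ toℕ j → toℕ j ≤ n ∸ 2 → c j < 0ℚ))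
theorem1p2 (suc (suc (suc d))) (ℕ.s≤s (ℕ.s≤s (ℕ.s≤s ℕ.z≤n))) with negative d
... | _ , G = g .P .size , g .P .V , g .P .vertex , g .P .fullDim , g .P .smooth , (λ j → ι (g .c (toℕ j))) ,
  (λ t _ → g .P .points t , g .P .unique t , g .P .complete t , count t) ,
  λ j 1≤j j≤n-2 → ι-mono-< (g .neg (toℕ j) 1≤j j≤n-2)
  where
  -- The theorem asks only for signs, so the growth parameter can be 0 at the last stage.
  g = G 0
  count : ∀ t → ι (+ length (g .P .points t)) ≡ Σℚ {4 ℕ.+ d} (λ j → ι (g .c (toℕ j)) ℚ.* powℚ (ι (+ t)) (toℕ j))
  count t = trans (cong ι (g .ehrhart t)) (ι-evalPoly (g .c) (4 ℕ.+ d) (+ t))
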